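{- Let $G$ be a multigraph with maximum edge multiplicity $\mu$ and maximum degree $\Delta$, and suppose $G$ contains no cycle of length $5$ as a subgraph. Let $M$ be a set of edges of $G$ such that the distance between any two distinct edges of $M$ is at least $5$. Suppose each edge of $M$ is assigned a colour from the palette $\mathcal{K}=\{1,\dots,\Delta+\mu\}$, arbitrarily. Then there is a proper edge-colouring of $G$ using only colours from $\mathcal{K}$ that agrees with this precolouring on $M$.
   Context: The distance between two edges is the number of edges in a shortest path between an endpoint of one and an endpoint of the other. A proper edge-colouring assigns colours to edges so that any two edges sharing an endpoint receive different colours (parallel edges share endpoints). Multigraphs may have parallel edges; the maximum edge multiplicity is the largest number of edges joining a single pair of vertices. -}

module Defs where

open import Data.Nat using (ℕ; zero; suc; _+_; _≤_; _⊔_)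
open import Data.Fin using (Fin; zero; suc; _≟_)
open import Data.Fin.Subset using (Subset; _∈_)
open import Data.List using (List; length; filter; allFin; map; foldr)
open import Data.Product using (_×_; _,_; proj₁; proj₂; Σ; ∃; ∃-syntax)
open import Data.Sum using (_⊎_)
open import Relation.Binary.PropositionalEquality using (_≡_; _≢_)
open import Relation.Nullary using (¬_)
open import Relation.Nullary.Decidable using (_⊎-dec_; _×-dec_)
open import Function.Definitions using (Injective)

record Multigraph (n m : ℕ) : Set where
  field
    ends     : Fin m → Fin n × Fin n
    loopless : ∀ e → proj₁ (ends e) ≢ proj₂ (ends e)

module _ {n m : ℕ} (G : Multigraph n m) where
  open Multigraph G

  IncidentTo : Fin n → Fin m → Set
  IncidentTo v e = (v ≡ proj₁ (ends e)) ⊎ (v ≡ proj₂ (ends e))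

  Joins : Fin m → Fin n → Fin n → Set
  Joins e u v = ((proj₁ (ends e) ≡ u) × (proj₂ (ends e) ≡ v))
              ⊎ ((proj₁ (ends e) ≡ v) × (proj₂ (ends e) ≡ u))

  degree : Fin n → ℕ
  degree v = length (filter (λ e → (v ≟ proj₁ (ends e)) ⊎-dec (v ≟ proj₂ (ends e))) (allFin m))

  multiplicity : Fin n → Fin n → ℕ
  multiplicity u v = length (filter
    (λ e → ((proj₁ (ends e) ≟ u) ×-dec (proj₂ (ends e) ≟ v))
           ⊎-dec ((proj₁ (ends e) ≟ v) ×-dec (proj₂ (ends e) ≟ u)))
    (allFin m))

  maxDegree : ℕ
  maxDegree = foldr _⊔_ 0 (map degree (allFin n))

  maxMultiplicity : ℕ
  maxMultiplicity = foldr _⊔_ 0 (map (λ u → foldr _⊔_ 0 (map (multiplicity u) (allFin n))) (allFin n))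

  Adjacent : Fin n → Fin n → Set
  Adjacent u v = ∃[ e ] Joins e u v

  -- G contains a cycle of length 5 as a subgraph: five distinct vertices
  -- c 0,…,c 4 with c i adjacent to c (i+1 mod 5).
  -- (Consecutive pairs are distinct pairs of vertices, so the five edges are
  -- automatically distinct.)
  HasC5 : Set
  HasC5 = Σ (Fin 5 → Fin n) λ c → Injective _≡_ _≡_ c
    × Adjacent (c zero) (c (suc zero))
    × Adjacent (c (suc zero)) (c (suc (suc zero)))
    × Adjacent (c (suc (suc zero))) (c (suc (suc (suc zero))))
    × Adjacent (c (suc (suc (suc zero)))) (c (suc (suc (suc (suc zero)))))
    × Adjacent (c (suc (suc (suc (suc zero))))) (c zero)

  data Walk : Fin n → Fin n → ℕ → Set where
    here : ∀ {u} → Walk u u zero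
    step : ∀ {u w v k} → Adjacent u w → Walk w v k → Walk u v (suc k)

  EdgeDistAtMost : ℕ → Fin m → Fin m → Set
  EdgeDistAtMost d e f = ∃[ x ] ∃[ y ] ∃[ k ]
    IncidentTo x e × IncidentTo y f × k ≤ d × Walk x y k

  EdgeDistAtLeast5 : Fin m → Fin m → Set
  EdgeDistAtLeast5 e f = ¬ EdgeDistAtMost 4 e f

  ShareEndpoint : Fin m → Fin m → Set
  ShareEndpoint e f = ∃[ v ] IncidentTo v e × IncidentTo v f

  -- proper edge-colouring with colours Fin k (standing for {1,…,k})
  IsProperEdgeColouring : {k : ℕ} → (Fin m → Fin k) → Set
  IsProperEdgeColouring c = ∀ e f → e ≢ f → ShareEndpoint e f → c e ≢ c f

{-# OPTIONS --safe #-}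
module Submission where

open import Defs
open import Data.Nat using (ℕ; zero; suc; _+_; _≤_; _<_; _⊔_; z≤n; s≤s)
import Data.Nat.Properties as ℕₚ
open import Data.Nat.Induction using (<-wellFounded)
open import Data.Fin using (Fin; zero; _≟_)
open import Data.Fin.Properties using (any?; all?)
open import Data.Fin.Subset using (Subset; _∈_; _∉_)
open import Data.Fin.Subset.Properties using (_∈?_)
open import Data.List using (List; []; _∷_; _++_; length; map; concatMap; filter; allFin; deduplicate; foldr)
open import Data.List.Properties using (length-++; length-map; length-tabulate)
open import Data.List.Membership.Propositional using (find; lose) renaming (_∈_ to _∈ₗ_; _∉_ to _∉ₗ_)
open import Data.List.Membership.Propositional.Properties using (∈-∃++; ∈-++⁺ˡ; ∈-++⁺ʳ; ∈-++⁻; ∈-map⁺; ∈-map⁻; ∈-filter⁺; ∈-filter⁻; ∈-allFin; ∈-concat⁺′; ∈-concat⁻′; ∈-deduplicate⁺; ∈-deduplicate⁻; ∈-length)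
import Data.List.Membership.DecPropositional as DecMembership
open import Data.List.Relation.Unary.Any using (here; there)
import Data.List.Relation.Unary.Any as Any
open import Data.List.Relation.Unary.All using ([]; _∷_)
import Data.List.Relation.Unary.All as All
open import Data.List.Relation.Unary.AllPairs using ([]; _∷_)
open import Data.List.Relation.Unary.Unique.Propositional using (Unique)
import Data.List.Relation.Unary.Unique.Propositional.Properties as Uniqueₚ
import Data.List.Relation.Unary.Unique.DecPropositional.Properties as DecUniqueₚ
open import Data.Vec using (Vec; lookup) renaming ([] to []ᵛ; _∷_ to _∷ᵛ_)
open import Data.Vec.Properties.WithK using ([]=-irrelevant)
open import Data.Vec.Relation.Unary.All using () renaming ([] to []ᵃ; _∷_ to _∷ᵃ_)
open import Data.Vec.Relation.Unary.AllPairs using () renaming ([] to []ᵖ; _∷_ to _∷ᵖ_)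
import Data.Vec.Relation.Unary.Unique.Propositional as UniqueVec
import Data.Vec.Relation.Unary.Unique.Propositional.Properties as UniqueVecₚ
open import Data.Product using (Σ; ∃-syntax; _×_; _,_; proj₁; proj₂)
open import Data.Sum using (_⊎_; inj₁; inj₂; [_,_]′)
open import Data.Empty using (⊥; ⊥-elim)
open import Function using (_∘_; id)
open import Induction.WellFounded using (Acc; acc)
open import Relation.Nullary using (¬_; Dec; yes; no)
open import Relation.Nullary.Decidable using (_⊎-dec_; _×-dec_; _→-dec_; ¬?; decidable-stable)
open import Relation.Unary using (Decidable)
open import Relation.Binary.PropositionalEquality using (_≡_; _≢_; refl; sym; trans; cong; subst; ≢-sym)

-- Reserve one colour, zero, as "blank" and let Δ + μ − 1 genuine colours be used properly.
-- Start with every edge blank.  A Vizing fan around a vertex a of a blank edge f either gives f a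
-- genuine colour, or, without any Kempe change, moves the blank to another edge at a whose far
-- end meets no blank edge: the fan can only stop at such a leaf, since a vertex meeting a blank
-- edge misses at least μ genuine colours.  Keep M blank and take as few blank edges as possible;
-- then the second alternative always holds, and moving blanks apart makes the blank edges a
-- matching containing M.
--
-- Now e = uv ∈ M may be given its prescribed colour j, and the edges of colour j at u and v made
-- blank instead, unless one of these, say ux, meets a blank edge xw ∉ M.  In that case a fan
-- around w replaces xw by a blank wℓ.  This harms no other edge of M, because a neighbour of w
-- or ℓ on such an edge would be within distance 4 of u.  Nor does it harm v if v already had an
-- edge of colour j: if that edge were vℓ, then u x w ℓ v would be a 5-cycle.

-- Counting with duplicate-free lists.

unique-⊆⇒length≤ : {A : Set} {xs ys : List A} → Unique xs →
  (∀ {x} → x ∈ₗ xs → x ∈ₗ ys) → length xs ≤ length ys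
unique-⊆⇒length≤ {xs = []}     []       _   = z≤n
unique-⊆⇒length≤ {xs = x ∷ xs} (x∉ ∷ u) inc with ∈-∃++ (inc (here refl))
... | as , bs , refl = begin
  suc (length xs)                  ≤⟨ s≤s (unique-⊆⇒length≤ u rest) ⟩
  suc (length (as ++ bs))          ≡⟨ cong suc (length-++ as) ⟩
  suc (length as + length bs)      ≡⟨ ℕₚ.+-suc (length as) (length bs) ⟨
  length as + length (x ∷ bs)      ≡⟨ length-++ as ⟨
  length (as ++ x ∷ bs)            ∎
  where
  open ℕₚ.≤-Reasoning
  rest : ∀ {y} → y ∈ₗ xs → y ∈ₗ as ++ bs
  rest y∈ with ∈-++⁻ as (inc (there y∈))
  ... | inj₁ p           = ∈-++⁺ˡ p
  ... | inj₂ (here refl) = ⊥-elim (All.lookup x∉ y∈ refl)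
  ... | inj₂ (there p)   = ∈-++⁺ʳ as p

unique⇒length≤ : ∀ {n} {xs : List (Fin n)} → Unique xs → length xs ≤ n
unique⇒length≤ {n} {xs} u =
  subst (length xs ≤_) (length-tabulate id) (unique-⊆⇒length≤ {ys = allFin n} u (λ {x} _ → ∈-allFin x))

unique-filter : ∀ {n} {P : Fin n → Set} (P? : Decidable P) → Unique (filter P? (allFin n))
unique-filter P? = Uniqueₚ.filter⁺ P? (Uniqueₚ.allFin⁺ _)

∈-filter-allFin⁺ : ∀ {n} {P : Fin n → Set} (P? : Decidable P) {x} → P x → x ∈ₗ filter P? (allFin n)
∈-filter-allFin⁺ P? {x} = ∈-filter⁺ P? (∈-allFin x)

∈-filter-allFin⁻ : ∀ {n} {P : Fin n → Set} (P? : Decidable P) {x} → x ∈ₗ filter P? (allFin n) → P x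
∈-filter-allFin⁻ {n} P? = proj₂ ∘ ∈-filter⁻ P? {xs = allFin n}

∈-concatMap⁺ : {A B : Set} (f : A → List B) {xs : List A} {x : A} {y : B} →
  x ∈ₗ xs → y ∈ₗ f x → y ∈ₗ concatMap f xs
∈-concatMap⁺ f x∈ y∈ = ∈-concat⁺′ y∈ (∈-map⁺ f x∈)

∈-concatMap⁻ : {A B : Set} (f : A → List B) (xs : List A) {y : B} →
  y ∈ₗ concatMap f xs → ∃[ x ] x ∈ₗ xs × y ∈ₗ f x
∈-concatMap⁻ f xs y∈ with ∈-concat⁻′ (map f xs) y∈
... | _ , y∈l , l∈ with ∈-map⁻ f l∈
... | x , x∈ , refl = x , x∈ , y∈l

unique-concatMap : {A B : Set} (f : A → List B) {xs : List A} → Unique xs →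
  (∀ {x} → x ∈ₗ xs → Unique (f x)) →
  (∀ {x y b} → x ∈ₗ xs → y ∈ₗ xs → b ∈ₗ f x → b ∈ₗ f y → x ≡ y) →
  Unique (concatMap f xs)
unique-concatMap f {[]}     []       _  _  = []
unique-concatMap f {x ∷ xs} (x∉ ∷ u) uf dj =
  Uniqueₚ.++⁺ (uf (here refl))
    (unique-concatMap f u (uf ∘ there) (λ p q → dj (there p) (there q)))
    λ { (b∈x , b∈rest) → let y , y∈ , b∈y = ∈-concatMap⁻ f xs b∈rest in
        All.lookup x∉ y∈ (dj (here refl) (there y∈) b∈x b∈y) }

length-concatMap-mono : {A B C : Set} (f : A → List B) (g : A → List C) (xs : List A) →
  (∀ {x} → x ∈ₗ xs → length (f x) ≤ length (g x)) →
  length (concatMap f xs) ≤ length (concatMap g xs)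
length-concatMap-mono f g []       _  = z≤n
length-concatMap-mono f g (x ∷ xs) le
  rewrite length-++ (f x) {concatMap f xs} | length-++ (g x) {concatMap g xs} =
  ℕₚ.+-mono-≤ (le (here refl)) (length-concatMap-mono f g xs (le ∘ there))

≤-foldr-⊔ : {A : Set} (f : A → ℕ) {xs : List A} {x : A} → x ∈ₗ xs → f x ≤ foldr _⊔_ 0 (map f xs)
≤-foldr-⊔ f (here refl) = ℕₚ.m≤m⊔n _ _
≤-foldr-⊔ f (there p)   = ℕₚ.≤-trans (≤-foldr-⊔ f p) (ℕₚ.m≤n⊔m _ _)

-- Incidence in a multigraph.

module Incidence {n m : ℕ} (G : Multigraph n m) where
  open Multigraph G public

  V E : Set
  V = Fin n
  E = Fin m

  infix 4 _∈ᵉ_ _∈ᵉ?_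
  _∈ᵉ_ : V → E → Set
  v ∈ᵉ e = IncidentTo G v e

  _∈ᵉ?_ : ∀ v e → Dec (v ∈ᵉ e)
  v ∈ᵉ? e = (v ≟ proj₁ (ends e)) ⊎-dec (v ≟ proj₂ (ends e))

  joins? : ∀ e u v → Dec (Joins G e u v)
  joins? e u v = ((proj₁ (ends e) ≟ u) ×-dec (proj₂ (ends e) ≟ v))
           ⊎-dec ((proj₁ (ends e) ≟ v) ×-dec (proj₂ (ends e) ≟ u))

  degree≤maxDegree : ∀ v → degree G v ≤ maxDegree G
  degree≤maxDegree v = ≤-foldr-⊔ (degree G) (∈-allFin v)

  multiplicity≤maxMultiplicity : ∀ u v → multiplicity G u v ≤ maxMultiplicity G
  multiplicity≤maxMultiplicity u v = ℕₚ.≤-trans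
    (≤-foldr-⊔ (multiplicity G u) (∈-allFin v))
    (≤-foldr-⊔ (λ w → foldr _⊔_ 0 (map (multiplicity G w) (allFin n))) (∈-allFin u))

  -- Meaningful only when `v` lies on `e`; otherwise the first end is an arbitrary default.
  opposite : V → E → V
  opposite v e with v ≟ proj₁ (ends e)
  ... | yes _ = proj₂ (ends e)
  ... | no  _ = proj₁ (ends e)

  joins-opposite : ∀ {v e} → v ∈ᵉ e → Joins G e v (opposite v e)
  joins-opposite {v} {e} v∈e with v ≟ proj₁ (ends e)
  joins-opposite v∈e         | yes p = inj₁ (sym p , refl)
  joins-opposite (inj₁ p)    | no ¬p = ⊥-elim (¬p p)
  joins-opposite (inj₂ p)    | no ¬p = inj₂ (refl , sym p)

  joins⇒∈ˡ : ∀ {e u v} → Joins G e u v → u ∈ᵉ e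
  joins⇒∈ˡ (inj₁ (p , _)) = inj₁ (sym p)
  joins⇒∈ˡ (inj₂ (_ , p)) = inj₂ (sym p)

  joins⇒∈ʳ : ∀ {e u v} → Joins G e u v → v ∈ᵉ e
  joins⇒∈ʳ (inj₁ (_ , p)) = inj₂ (sym p)
  joins⇒∈ʳ (inj₂ (p , _)) = inj₁ (sym p)

  joins-sym : ∀ {e u v} → Joins G e u v → Joins G e v u
  joins-sym (inj₁ p) = inj₂ p
  joins-sym (inj₂ p) = inj₁ p

  joins⇒≢ : ∀ {e u v} → Joins G e u v → u ≢ v
  joins⇒≢ {e} (inj₁ (refl , refl)) p = loopless e p
  joins⇒≢ {e} (inj₂ (refl , refl)) p = loopless e (sym p)

  joins-only : ∀ {e u v w} → Joins G e u v → w ∈ᵉ e → w ≡ u ⊎ w ≡ v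
  joins-only (inj₁ (p , q)) (inj₁ r) = inj₁ (trans r p)
  joins-only (inj₁ (p , q)) (inj₂ r) = inj₂ (trans r q)
  joins-only (inj₂ (p , q)) (inj₁ r) = inj₂ (trans r p)
  joins-only (inj₂ (p , q)) (inj₂ r) = inj₁ (trans r q)

  opposite∈ : ∀ {v e} → v ∈ᵉ e → opposite v e ∈ᵉ e
  opposite∈ v∈e = joins⇒∈ʳ (joins-opposite v∈e)

  opposite≢ : ∀ {v e} → v ∈ᵉ e → v ≢ opposite v e
  opposite≢ v∈e = joins⇒≢ (joins-opposite v∈e)

  ∈-opposite : ∀ {v w e} → v ∈ᵉ e → w ∈ᵉ e → w ≡ v ⊎ w ≡ opposite v e
  ∈-opposite v∈e = joins-only (joins-opposite v∈e)

  ∈∈⇒joins : ∀ {v w e} → v ∈ᵉ e → w ∈ᵉ e → v ≢ w → Joins G e v w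
  ∈∈⇒joins v∈e w∈e v≢w with ∈-opposite v∈e w∈e
  ... | inj₁ p    = ⊥-elim (v≢w (sym p))
  ... | inj₂ refl = joins-opposite v∈e

  incident : V → List E
  incident v = filter (v ∈ᵉ?_) (allFin m)

  between : V → V → List E
  between u v = filter (λ e → joins? e u v) (allFin m)

  infix 4 _∈ˡ?_
  _∈ˡ?_ : ∀ {N} (x : Fin N) (xs : List (Fin N)) → Dec (x ∈ₗ xs)
  _∈ˡ?_ = DecMembership._∈?_ _≟_

-- Edge-colourings with a blank colour.

module Colourings {n m : ℕ} (G : Multigraph n m) (k : ℕ) where
  open Incidence G public

  -- Colour zero means "blank": properness ignores it.
  Colour : Set
  Colour = Fin (suc k)

  Colouring : Set
  Colouring = E → Colour

  Proper : Colouring → Set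
  Proper c = ∀ {e f v} → v ∈ᵉ e → v ∈ᵉ f → c e ≡ c f → c e ≢ zero → e ≡ f

  Misses : Colouring → V → Colour → Set
  Misses c v b = b ≢ zero × (∀ e → v ∈ᵉ e → c e ≢ b)

  misses? : ∀ (c : Colouring) v (b : Colour) → Dec (Misses c v b)
  misses? c v b = ¬? (b ≟ zero) ×-dec all? (λ e → (v ∈ᵉ? e) →-dec ¬? (c e ≟ b))

  Covered : Colouring → V → Set
  Covered c v = ∃[ e ] v ∈ᵉ e × c e ≡ zero

  covered? : ∀ (c : Colouring) v → Dec (Covered c v)
  covered? c v = any? (λ e → (v ∈ᵉ? e) ×-dec (c e ≟ zero))

  has? : ∀ (c : Colouring) v (b : Colour) → Dec (∃[ e ] v ∈ᵉ e × c e ≡ b)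
  has? c v b = any? (λ e → (v ∈ᵉ? e) ×-dec (c e ≟ b))

  ¬misses⇒has : ∀ (c : Colouring) v {b : Colour} → b ≢ zero → ¬ Misses c v b → ∃[ e ] v ∈ᵉ e × c e ≡ b
  ¬misses⇒has c v {b} b≢0 ¬ms =
    decidable-stable (has? c v b) λ ¬h → ¬ms (b≢0 , λ e v∈e p → ¬h (e , v∈e , p))

  missing : Colouring → V → List Colour
  missing c v = filter (misses? c v) (allFin (suc k))

  -- The blank edges at v account for colour zero, so one of them saves a colour.
  covered⇒many-missing : ∀ c {v} → Covered c v → suc k ≤ length (missing c v) + degree G v
  covered⇒many-missing c {v} (z , v∈z , cz≡0) = begin
    suc k                                                   ≡⟨ length-tabulate id ⟨
    length (allFin (suc k))                                 ≤⟨ unique-⊆⇒length≤ (Uniqueₚ.allFin⁺ _) inc ⟩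
    length (missing c v ++ map c (incident v))              ≡⟨ length-++ (missing c v) ⟩
    length (missing c v) + length (map c (incident v))      ≡⟨ cong (length (missing c v) +_) (length-map c (incident v)) ⟩
    length (missing c v) + degree G v                       ∎
    where
    open ℕₚ.≤-Reasoning
    present : ∀ {e} → v ∈ᵉ e → c e ∈ₗ missing c v ++ map c (incident v)
    present v∈e = ∈-++⁺ʳ (missing c v) (∈-map⁺ c (∈-filter-allFin⁺ (v ∈ᵉ?_) v∈e))
    inc : ∀ {b} → b ∈ₗ allFin (suc k) → b ∈ₗ missing c v ++ map c (incident v)
    inc {b} _ with misses? c v b
    ... | yes ms = ∈-++⁺ˡ (∈-filter-allFin⁺ (misses? c v) ms)
    ... | no ¬ms with b ≟ zero
    ...   | yes refl = subst (_∈ₗ missing c v ++ map c (incident v)) cz≡0 (present v∈z)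
    ...   | no b≢0   = let e , v∈e , p = ¬misses⇒has c v b≢0 ¬ms in subst (_∈ₗ missing c v ++ map c (incident v)) p (present v∈e)

  _[_≔_] : Colouring → E → Colour → Colouring
  (c [ g ≔ b ]) e with e ≟ g
  ... | yes _ = b
  ... | no  _ = c e

  updated : ∀ (c : Colouring) g b → (c [ g ≔ b ]) g ≡ b
  updated c g b with g ≟ g
  ... | yes _ = refl
  ... | no ¬p = ⊥-elim (¬p refl)

  unchanged : ∀ (c : Colouring) {g b e} → e ≢ g → (c [ g ≔ b ]) e ≡ c e
  unchanged c {g} {b} {e} e≢g with e ≟ g
  ... | yes p = ⊥-elim (e≢g p)
  ... | no  _ = refl

  proper-erase : ∀ {c} → Proper c → ∀ g → Proper (c [ g ≔ zero ])
  proper-erase pc g {e} {f} v∈e v∈f eq ≢0 with e ≟ g | f ≟ g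
  ... | yes _ | _     = ⊥-elim (≢0 refl)
  ... | no  _ | yes _ = ⊥-elim (≢0 eq)
  ... | no  _ | no  _ = pc v∈e v∈f eq ≢0

  proper-paint : ∀ {c} → Proper c → ∀ {g b} →
    (∀ {v e} → v ∈ᵉ g → v ∈ᵉ e → e ≢ g → c e ≢ b) → Proper (c [ g ≔ b ])
  proper-paint pc {g} free {e} {f} v∈e v∈f eq ≢0 with e ≟ g | f ≟ g
  ... | yes p    | yes q    = trans p (sym q)
  ... | yes refl | no f≢g   = ⊥-elim (free v∈e v∈f f≢g (sym eq))
  ... | no e≢g   | yes refl = ⊥-elim (free v∈f v∈e e≢g eq)
  ... | no  _    | no  _    = pc v∈e v∈f eq ≢0

  -- Kempe changes.

  module Transposition (α β : Colour) where
    swap : Colour → Colour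
    swap x with x ≟ α | x ≟ β
    ... | yes _ | _     = β
    ... | no  _ | yes _ = α
    ... | no  _ | no  _ = x

    swap-α : swap α ≡ β
    swap-α with α ≟ α | α ≟ β
    ... | yes _ | _ = refl
    ... | no ¬p | _ = ⊥-elim (¬p refl)

    swap-β : swap β ≡ α
    swap-β with β ≟ α | β ≟ β
    ... | yes p | _     = p
    ... | no  _ | yes _ = refl
    ... | no  _ | no ¬p = ⊥-elim (¬p refl)

    swap-other : ∀ {x} → x ≢ α → x ≢ β → swap x ≡ x
    swap-other {x} x≢α x≢β with x ≟ α | x ≟ β
    ... | yes p | _     = ⊥-elim (x≢α p)
    ... | no  _ | yes p = ⊥-elim (x≢β p)
    ... | no  _ | no  _ = refl

    swap-involutive : ∀ x → swap (swap x) ≡ x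
    swap-involutive x with x ≟ α | x ≟ β
    ... | yes refl | _        = swap-β
    ... | no  _    | yes refl = swap-α
    ... | no  x≢α  | no x≢β   = swap-other x≢α x≢β

    swap-injective : ∀ {x y} → swap x ≡ swap y → x ≡ y
    swap-injective {x} {y} p = trans (sym (swap-involutive x)) (trans (cong swap p) (swap-involutive y))

  module Kempe {c : Colouring} (pc : Proper c) {α β : Colour}
               (α≢0 : α ≢ zero) (β≢0 : β ≢ zero) (α≢β : α ≢ β) where
    open Transposition α β

    Bicoloured : E → Set
    Bicoloured e = c e ≡ α ⊎ c e ≡ β

    -- The α/β-component of `a`, kept as a closed vertex set. It arises as an alternating path from
    -- `a` to `last`, and `inner` remembers only that every other member sees both colours.
    record Component (a : V) : Set where
      field
        members : List V
        root∈   : a ∈ₗ members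
        closed  : ∀ {z y e} → z ∈ₗ members → z ∈ᵉ e → Bicoloured e → y ∈ᵉ e → y ∈ₗ members
        last    : V
        inner   : ∀ {z γ} → z ∈ₗ members → z ≢ a → z ≢ last → γ ≡ α ⊎ γ ≡ β → ¬ Misses c z γ

    -- An alternating path from a to x, entering x by colour γ and due to leave it by δ.
    record Path (a x : V) (γ δ : Colour) : Set where
      field
        vertices : List V
        edges    : List E
        unique   : Unique vertices
        start∈   : a ∈ₗ vertices
        end∈     : x ∈ₗ vertices
        γδ       : (γ ≡ α × δ ≡ β) ⊎ (γ ≡ β × δ ≡ α)
        used     : ∀ {z e} → z ∈ₗ vertices → z ≢ x → z ∈ᵉ e → Bicoloured e → e ∈ₗ edges
        end-in   : ∀ {e} → e ∈ₗ edges → x ∈ᵉ e → c e ≡ γ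
        end-used : ∀ {e} → x ∈ᵉ e → c e ≡ γ → e ∈ₗ edges
        within   : ∀ {e y} → e ∈ₗ edges → y ∈ᵉ e → y ∈ₗ vertices
        inner    : ∀ {z ε} → z ∈ₗ vertices → z ≢ a → z ≢ x → ε ≡ α ⊎ ε ≡ β → ¬ Misses c z ε
        end-has  : x ≢ a → ¬ Misses c x γ

    module _ {a : V} where

      bicoloured : ∀ {γ δ} → (γ ≡ α × δ ≡ β) ⊎ (γ ≡ β × δ ≡ α) → ∀ {ε} → ε ≡ α ⊎ ε ≡ β → ε ≡ γ ⊎ ε ≡ δ
      bicoloured (inj₁ (refl , refl)) p        = p
      bicoloured (inj₂ (refl , refl)) (inj₁ p) = inj₂ p
      bicoloured (inj₂ (refl , refl)) (inj₂ p) = inj₁ p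

      nonzero : ∀ {γ δ} → (γ ≡ α × δ ≡ β) ⊎ (γ ≡ β × δ ≡ α) → δ ≢ zero
      nonzero (inj₁ (refl , refl)) = β≢0
      nonzero (inj₂ (refl , refl)) = α≢0

      distinct : ∀ {γ δ} → (γ ≡ α × δ ≡ β) ⊎ (γ ≡ β × δ ≡ α) → γ ≢ δ
      distinct (inj₁ (refl , refl)) = α≢β
      distinct (inj₂ (refl , refl)) = ≢-sym α≢β

      flip : ∀ {γ δ} → (γ ≡ α × δ ≡ β) ⊎ (γ ≡ β × δ ≡ α) → (δ ≡ α × γ ≡ β) ⊎ (δ ≡ β × γ ≡ α)
      flip (inj₁ (p , q)) = inj₂ (q , p)
      flip (inj₂ (p , q)) = inj₁ (q , p)

      isBicoloured : ∀ {γ δ} → (γ ≡ α × δ ≡ β) ⊎ (γ ≡ β × δ ≡ α) → δ ≡ α ⊎ δ ≡ β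
      isBicoloured (inj₁ (_ , q)) = inj₂ q
      isBicoloured (inj₂ (_ , q)) = inj₁ q

      -- No edge of colour α meets `a`, so the path without edges may count as having entered `a` by
      -- α.
      singleton : Misses c a α → Path a a α β
      singleton ms = record
        { vertices = a ∷ [] ; edges = [] ; unique = [] ∷ []
        ; start∈ = here refl ; end∈ = here refl ; γδ = inj₁ (refl , refl)
        ; used = λ { (here p) q → ⊥-elim (q p) }
        ; end-in = λ () ; end-used = λ a∈e p → ⊥-elim (proj₂ ms _ a∈e p)
        ; within = λ ()
        ; inner = λ { (here p) q → ⊥-elim (q p) } ; end-has = λ p → ⊥-elim (p refl) }

      finish : ∀ {x γ δ} → Path a x γ δ → ¬ (∃[ e ] x ∈ᵉ e × c e ≡ δ) → Component a
      finish {x} {γ} {δ} P ¬out = record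
        { members = vertices ; root∈ = start∈ ; closed = cl ; last = x ; inner = inner }
        where
        open Path P
        cl : ∀ {z y e} → z ∈ₗ vertices → z ∈ᵉ e → Bicoloured e → y ∈ᵉ e → y ∈ₗ vertices
        cl {z} z∈ z∈e bi y∈e with z ≟ x
        ... | no z≢x   = within (used z∈ z≢x z∈e bi) y∈e
        ... | yes refl with bicoloured γδ bi
        ...   | inj₁ p = within (end-used z∈e p) y∈e
        ...   | inj₂ p = ⊥-elim (¬out (_ , z∈e , p))

      advance : ∀ {x γ δ e} (P : Path a x γ δ) → (x∈e : x ∈ᵉ e) → c e ≡ δ →
        Σ (Path a (opposite x e) δ γ) λ Q → length (Path.vertices Q) ≡ suc (length (Path.vertices P))
      advance {x} {γ} {δ} {e} P x∈e ce≡δ = record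
        { vertices = y ∷ vertices ; edges = e ∷ edges
        ; unique = All.tabulate (λ z∈ y≡z → y∉ (subst (_∈ₗ vertices) (sym y≡z) z∈)) ∷ unique
        ; start∈ = there start∈ ; end∈ = here refl ; γδ = flip γδ
        ; used = used′
        ; end-in = λ { (here refl) _ → ce≡δ ; (there q) y∈ → ⊥-elim (y∉ (within q y∈)) }
        ; end-used = λ y∈e′ p → here (pc y∈e′ y∈e (trans p (sym ce≡δ)) (λ q → nonzero γδ (trans (sym p) q)))
        ; within = λ { (here refl) q → [ (λ { refl → there end∈ }) , (λ { refl → here refl }) ]′ (∈-opposite x∈e q)
                     ; (there p) q → there (within p q) }
        ; inner = inner′
        ; end-has = λ _ ms → proj₂ ms e y∈e ce≡δ } , refl
        where
        open Path P
        y = opposite x e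
        y∈e = opposite∈ x∈e
        bi : Bicoloured e
        bi = [ (λ p → inj₁ (trans ce≡δ p)) , (λ p → inj₂ (trans ce≡δ p)) ]′ (isBicoloured γδ)
        -- If `y` were on the path already, `e` would be among its edges and so meet `x` in colour
        -- γ, not δ.
        y∉ : y ∉ₗ vertices
        y∉ y∈ = distinct γδ (trans (sym (end-in (used y∈ (≢-sym (opposite≢ x∈e)) y∈e bi) x∈e)) ce≡δ)
        used′ : ∀ {z e′} → z ∈ₗ y ∷ vertices → z ≢ y → z ∈ᵉ e′ → Bicoloured e′ → e′ ∈ₗ e ∷ edges
        used′ (here p) z≢y _ _ = ⊥-elim (z≢y p)
        used′ {z} (there z∈) _ z∈e′ bi′ with z ≟ x
        ... | no z≢x   = there (used z∈ z≢x z∈e′ bi′)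
        ... | yes refl with bicoloured γδ bi′
        ...   | inj₁ p = there (end-used z∈e′ p)
        ...   | inj₂ p = here (pc z∈e′ x∈e (trans p (sym ce≡δ)) (λ q → nonzero γδ (trans (sym p) q)))
        inner′ : ∀ {z ε} → z ∈ₗ y ∷ vertices → z ≢ a → z ≢ y → ε ≡ α ⊎ ε ≡ β → ¬ Misses c z ε
        inner′ (here p) _ z≢y _ = ⊥-elim (z≢y p)
        inner′ {z} (there z∈) z≢a _ q with z ≟ x
        ... | no z≢x   = inner z∈ z≢a z≢x q
        ... | yes refl with bicoloured γδ q
        ...   | inj₁ refl = end-has z≢a
        ...   | inj₂ refl = λ ms → proj₂ ms e x∈e ce≡δ

      -- Path vertices are distinct, so at most `n` of them fit; the fuel `d` runs out only by
      -- contradiction.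
      extend : ∀ d {x γ δ} (P : Path a x γ δ) → n < d + length (Path.vertices P) → Component a
      extend zero P lt = ⊥-elim (ℕₚ.<⇒≱ lt (unique⇒length≤ (Path.unique P)))
      extend (suc d) {x} {γ} {δ} P lt with has? c x δ
      ... | no ¬out             = finish P ¬out
      ... | yes (e , x∈e , p) with advance P x∈e p
      ...   | Q , len = extend d Q (subst (n <_) (trans (sym (ℕₚ.+-suc d _)) (cong (d +_) (sym len))) lt)

      component : Misses c a α → Component a
      component ms = extend n (singleton ms) (ℕₚ.m<m+n n (s≤s z≤n))

    module Swap {a : V} (K : Component a) where
      open Component K

      -- The swap is made outside the component, so that edges at the centre keep their colours.
      -- Testing one end suffices: a bicoloured edge has both ends inside or both outside, and the
      -- swap fixes all other colours.
      recoloured : Colouring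
      recoloured e with proj₁ (ends e) ∈ˡ? members
      ... | yes _ = c e
      ... | no  _ = swap (c e)

      bicoloured? : ∀ e → Dec (Bicoloured e)
      bicoloured? e = (c e ≟ α) ⊎-dec (c e ≟ β)

      fixed : ∀ {e} → ¬ Bicoloured e → swap (c e) ≡ c e
      fixed ¬bi = swap-other (¬bi ∘ inj₁) (¬bi ∘ inj₂)

      inside : ∀ {v e} → v ∈ₗ members → v ∈ᵉ e → recoloured e ≡ c e
      inside {v} {e} v∈ v∈e with proj₁ (ends e) ∈ˡ? members
      ... | yes _ = refl
      ... | no ¬p with bicoloured? e
      ...   | yes bi = ⊥-elim (¬p (closed v∈ v∈e bi (inj₁ refl)))
      ...   | no ¬bi = fixed ¬bi

      outside : ∀ {v e} → v ∉ₗ members → v ∈ᵉ e → recoloured e ≡ swap (c e)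
      outside {v} {e} v∉ v∈e with proj₁ (ends e) ∈ˡ? members
      ... | no  _ = refl
      ... | yes p with bicoloured? e
      ...   | yes bi = ⊥-elim (v∉ (closed p (inj₁ refl) bi v∈e))
      ...   | no ¬bi = sym (fixed ¬bi)

      swap-zero : swap zero ≡ zero
      swap-zero = swap-other (≢-sym α≢0) (≢-sym β≢0)

      blank⁺ : ∀ {e} → c e ≡ zero → recoloured e ≡ zero
      blank⁺ {e} p with proj₁ (ends e) ∈ˡ? members
      ... | yes _ = p
      ... | no  _ = trans (cong swap p) swap-zero

      blank⁻ : ∀ {e} → recoloured e ≡ zero → c e ≡ zero
      blank⁻ {e} p with proj₁ (ends e) ∈ˡ? members
      ... | yes _ = p
      ... | no  _ = swap-injective (trans p (sym swap-zero))

      recoloured-proper : Proper recoloured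
      recoloured-proper {e} {f} {v} v∈e v∈f eq ≢0 with v ∈ˡ? members
      ... | yes v∈ = pc v∈e v∈f (trans (sym (inside v∈ v∈e)) (trans eq (inside v∈ v∈f))) (≢0 ∘ blank⁺)
      ... | no v∉  = pc v∈e v∈f
        (swap-injective (trans (sym (outside v∉ v∈e)) (trans eq (outside v∉ v∈f)))) (≢0 ∘ blank⁺)

      misses-inside : ∀ {v d} → v ∈ₗ members → Misses c v d → Misses recoloured v d
      misses-inside v∈ (d≢0 , ms) = d≢0 , λ e v∈e p → ms e v∈e (trans (sym (inside v∈ v∈e)) p)

      misses-outside : ∀ {v} → v ∉ₗ members → Misses c v β → Misses recoloured v α
      misses-outside v∉ (_ , ms) = α≢0 , λ e v∈e p → ms e v∈e
        (swap-injective (trans (sym (outside v∉ v∈e)) (trans p (sym swap-β))))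

      misses-other : ∀ {v d} → d ≢ α → d ≢ β → Misses c v d → Misses recoloured v d
      misses-other {v} {d} d≢α d≢β (d≢0 , ms) with v ∈ˡ? members
      ... | yes v∈ = misses-inside v∈ (d≢0 , ms)
      ... | no v∉  = d≢0 , λ e v∈e p → ms e v∈e
        (swap-injective (trans (sym (outside v∉ v∈e)) (trans p (sym (swap-other d≢α d≢β)))))

      -- Among members other than `a`, only `last` can miss a colour of the pair.
      at-most-one : ∀ {q r} → q ≢ a → r ≢ a → Misses c q β → Misses c r β →
        q ∈ₗ members → r ∈ₗ members → q ≡ r
      at-most-one {q} {r} q≢a r≢a mq mr q∈ r∈ with q ≟ last | r ≟ last
      ... | yes p | yes p′ = trans p (sym p′)
      ... | no ¬p | _      = ⊥-elim (inner q∈ q≢a ¬p (inj₂ refl) mq)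
      ... | _     | no ¬p  = ⊥-elim (inner r∈ r≢a ¬p (inj₂ refl) mr)

-- Vizing fans in a colouring with blank edges.

module VizingFan {n m : ℕ} (G : Multigraph n m) (k D μ : ℕ)
  (degree≤ : ∀ v → degree G v ≤ D) (multiplicity≤ : ∀ u v → multiplicity G u v ≤ μ)
  (enough : D + μ ≡ suc k) where
  open Colourings G k public

  -- With one edge at `v` blank, at most `D` minus one colours are used there, out of `D + μ` minus
  -- one genuine ones.
  μ≤missing : ∀ c {v} → Covered c v → μ ≤ length (missing c v)
  μ≤missing c {v} cov = ℕₚ.+-cancelˡ-≤ D _ _ (begin
    D + μ                              ≡⟨ enough ⟩
    suc k                              ≤⟨ covered⇒many-missing c cov ⟩
    length (missing c v) + degree G v  ≤⟨ ℕₚ.+-monoʳ-≤ _ (degree≤ v) ⟩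
    length (missing c v) + D           ≡⟨ ℕₚ.+-comm _ D ⟩
    D + length (missing c v)           ∎)
    where open ℕₚ.≤-Reasoning

  -- The blank edges afterwards are exactly the earlier ones without `f`; other edges may change
  -- colour freely, which leaves room for a Kempe change.
  record Filled (c : Colouring) (f : E) : Set where
    field
      colouring : Colouring
      proper    : Proper colouring
      filled    : colouring f ≢ zero
      blank⁺    : ∀ {e} → e ≢ f → c e ≡ zero → colouring e ≡ zero
      blank⁻    : ∀ {e} → colouring e ≡ zero → c e ≡ zero

  -- Here no Kempe change takes place: `local` records that only edges at `a` are recoloured.
  record Moved (c : Colouring) (a : V) (f : E) : Set where
    field
      colouring : Colouring
      proper    : Proper colouring
      filled    : colouring f ≢ zero
      target    : E
      a∈target  : a ∈ᵉ target
      uncovered : ¬ Covered c (opposite a target)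
      emptied   : colouring target ≡ zero
      blank⁺    : ∀ {e} → e ≢ f → c e ≡ zero → colouring e ≡ zero
      blank⁻    : ∀ {e} → colouring e ≡ zero → e ≢ target → c e ≡ zero
      local     : ∀ {e} → ¬ a ∈ᵉ e → colouring e ≡ c e

  module _ {a : V} {f : E} (a∈f : a ∈ᵉ f) where

    leaf : E → V
    leaf = opposite a

    -- A fan in tree form, newest edge first: `h` may hang from any earlier edge `g`, and parallel
    -- edges may share a leaf.
    data Fan (c : Colouring) : List E → Set where
      root : Fan c (f ∷ [])
      grow : ∀ {L g h} → Fan c L → g ∈ₗ L → a ∈ᵉ h → h ∉ₗ L → Misses c (leaf g) (c h) → Fan c (h ∷ L)

    root∈ : ∀ {c L} → Fan c L → f ∈ₗ L
    root∈ root             = here refl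
    root∈ (grow F _ _ _ _) = there (root∈ F)

    centre∈ : ∀ {c L g} → Fan c L → g ∈ₗ L → a ∈ᵉ g
    centre∈ root               (here refl) = a∈f
    centre∈ (grow _ _ a∈h _ _) (here refl) = a∈h
    centre∈ (grow F _ _ _ _)   (there g∈)  = centre∈ F g∈

    coloured : ∀ {c L g} → Fan c L → g ∈ₗ L → g ≢ f → c g ≢ zero
    coloured root                        (here p)    g≢f = ⊥-elim (g≢f p)
    coloured (grow _ _ _ _ (≢0 , _))     (here refl) _   = ≢0
    coloured (grow F _ _ _ _)            (there g∈)  g≢f = coloured F g∈ g≢f

    fan-unique : ∀ {c L} → Fan c L → Unique L
    fan-unique root               = [] ∷ []
    fan-unique (grow {L} F _ _ h∉ _) =
      All.tabulate (λ g∈ p → h∉ (subst (_∈ₗ L) (sym p) g∈)) ∷ fan-unique F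

    -- `on` tracks only where colours come from: the other fan edges carry nonblank colours already
    -- present at the centre, so a colour missing there stays missing.
    record Shift (c : Colouring) (L : List E) (g : E) : Set where
      field
        colouring : Colouring
        proper    : Proper colouring
        off       : ∀ {e} → e ∉ₗ L → colouring e ≡ c e
        on        : ∀ {e} → e ∈ₗ L → e ≢ g → ∃[ e′ ] e′ ∈ₗ L × colouring e ≡ c e′ × c e′ ≢ zero
        emptied   : colouring g ≡ zero

    module _ {c : Colouring} (pc : Proper c) (cf≡0 : c f ≡ zero) where

      -- Every edge on the way from the root to g takes the colour of its successor.
      shift : ∀ {L g} → Fan c L → g ∈ₗ L → Shift c L g
      shift root (here refl) = record
        { colouring = c ; proper = pc ; off = λ _ → refl
        ; on = λ { (here p) q → ⊥-elim (q p) } ; emptied = cf≡0 }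
      shift (grow {L} {g} {h} F g∈ a∈h h∉ ms) (there t∈) = record
        { colouring = colouring ; proper = proper ; off = λ e∉ → off (e∉ ∘ there)
        ; on = λ { (here refl) _ → h , here refl , off h∉ , proj₁ ms
                 ; (there e∈) q → let e′ , e′∈ , r = on e∈ q in e′ , there e′∈ , r }
        ; emptied = emptied }
        where open Shift (shift F t∈)
      shift (grow {L} {g} {h} F g∈ a∈h h∉ ms) (here refl) = record
        { colouring = c₂
        ; proper = proper-paint (proper-erase proper h) free
        ; off = λ {e} e∉ → trans (unchanged c₁ {g} {c h} {e} (λ { refl → e∉ (there g∈) }))
                                 (trans (unchanged c₀ {h} {zero} {e} (λ { refl → e∉ (here refl) })) (off (e∉ ∘ there)))
        ; on = on′
        ; emptied = trans (unchanged c₁ {g} {c h} (≢-sym g≢h)) (updated c₀ h zero) }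
        where
        open Shift (shift F g∈) renaming (colouring to c₀)
        c₁ c₂ : Colouring
        c₁ = c₀ [ h ≔ zero ]
        c₂ = c₁ [ g ≔ c h ]
        g≢h : g ≢ h
        g≢h refl = h∉ g∈
        -- Once `h` is erased, `c h` is absent at both ends of `g`: fan edges carry colours from
        -- `L`, `h` was the only edge at `a` coloured `c h`, and the leaf misses it.
        free : ∀ {v e} → v ∈ᵉ g → v ∈ᵉ e → e ≢ g → c₁ e ≢ c h
        free {v} {e} v∈g v∈e e≢g p with e ≟ h
        ... | yes refl = proj₁ ms (sym p)
        ... | no e≢h with e ∈ˡ? L
        ...   | yes e∈ = let e′ , e′∈ , q , ≢0 = on e∈ e≢g in
                h∉ (subst (_∈ₗ L) (pc (centre∈ F e′∈) a∈h (trans (sym q) p) ≢0) e′∈)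
        ...   | no e∉ with ∈-opposite (centre∈ F g∈) v∈g
        ...     | inj₁ refl = e≢h (sym (pc a∈h v∈e (sym (trans (sym (off e∉)) p)) (proj₁ ms)))
        ...     | inj₂ refl = proj₂ ms e v∈e (trans (sym (off e∉)) p)
        on′ : ∀ {e} → e ∈ₗ h ∷ L → e ≢ h → ∃[ e′ ] e′ ∈ₗ h ∷ L × c₂ e ≡ c e′ × c e′ ≢ zero
        on′ (here p) q = ⊥-elim (q p)
        on′ {e} (there e∈) e≢h = by (e ≟ g)
          where
          by : Dec (e ≡ g) → ∃[ e′ ] e′ ∈ₗ h ∷ L × c₂ e ≡ c e′ × c e′ ≢ zero
          by (yes refl) = h , here refl , updated c₁ g (c h) , proj₁ ms
          by (no e≢g)   = let e′ , e′∈ , q , ≢0 = on e∈ e≢g in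
            e′ , there e′∈ , trans (unchanged c₁ {g} {c h} e≢g) (trans (unchanged c₀ {h} {zero} e≢h) q) , ≢0

      -- After the shift to `g`, colour `b` is free at both its ends. Fan edges parallel to `g` do
      -- no harm, since their new colours come from edges at `a`, which misses `b`.
      complete : ∀ {L g b} → Fan c L → g ∈ₗ L → Misses c (leaf g) b → Misses c a b → Filled c f
      complete {L} {g} {b} F g∈ (b≢0 , msℓ) (_ , msa) = record
        { colouring = c₁
        ; proper    = proper-paint proper free
        ; filled    = on₁ (root∈ F)
        ; blank⁺    = λ e≢f p → trans (off₁ λ e∈ → coloured F e∈ e≢f p) p
        ; blank⁻    = blank }
        where
        open Shift (shift F g∈) renaming (colouring to c₀)
        c₁ : Colouring
        c₁ = c₀ [ g ≔ b ]
        free : ∀ {v e} → v ∈ᵉ g → v ∈ᵉ e → e ≢ g → c₀ e ≢ b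
        free {v} {e} v∈g v∈e e≢g p with e ∈ˡ? L
        ... | yes e∈ = let e′ , e′∈ , q , _ = on e∈ e≢g in msa e′ (centre∈ F e′∈) (trans (sym q) p)
        ... | no e∉ with ∈-opposite (centre∈ F g∈) v∈g
        ...   | inj₁ refl = msa e v∈e (trans (sym (off e∉)) p)
        ...   | inj₂ refl = msℓ e v∈e (trans (sym (off e∉)) p)
        on₁ : ∀ {e} → e ∈ₗ L → c₁ e ≢ zero
        on₁ {e} e∈ p with e ≟ g
        ... | yes refl = b≢0 p
        ... | no e≢g   = let _ , _ , q , ≢0 = on e∈ e≢g in ≢0 (trans (sym q) p)
        off₁ : ∀ {e} → e ∉ₗ L → c₁ e ≡ c e
        off₁ e∉ = trans (unchanged c₀ {g} {b} (λ { refl → e∉ g∈ })) (off e∉)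
        blank : ∀ {e} → c₁ e ≡ zero → c e ≡ zero
        blank {e} p with e ∈ˡ? L
        ... | yes e∈ = ⊥-elim (on₁ e∈ p)
        ... | no e∉  = trans (sym (off₁ e∉)) p

      move : ∀ {L h} → Fan c L → h ∈ₗ L → ¬ Covered c (leaf h) → Moved c a f
      move {L} {h} F h∈ ¬cov = record
        { colouring = colouring ; proper = proper
        ; filled = λ p → let _ , _ , q , ≢0 = on (root∈ F) f≢h in ≢0 (trans (sym q) p)
        ; target = h ; a∈target = centre∈ F h∈ ; uncovered = ¬cov ; emptied = emptied
        ; blank⁺ = λ e≢f p → trans (off λ e∈ → coloured F e∈ e≢f p) p
        ; blank⁻ = blank
        ; local = λ a∉e → off λ e∈ → a∉e (centre∈ F e∈) }
        where
        open Shift (shift F h∈)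
        f≢h : f ≢ h
        f≢h refl = ¬cov (f , opposite∈ a∈f , cf≡0)
        blank : ∀ {e} → colouring e ≡ zero → e ≢ h → c e ≡ zero
        blank {e} p e≢h with e ∈ˡ? L
        ... | yes e∈ = let _ , _ , q , ≢0 = on e∈ e≢h in ⊥-elim (≢0 (trans (sym q) p))
        ... | no e∉  = trans (sym (off e∉)) p

      -- A fan at which neither outcome has appeared. By `disjoint` and `busy`, the centre and the
      -- leaves form an elementary set: no colour is missing at two distinct vertices of it.
      record Elementary (L : List E) : Set where
        field
          fan      : Fan c L
          covered  : ∀ {g} → g ∈ₗ L → Covered c (leaf g)
          disjoint : ∀ {g h b} → g ∈ₗ L → h ∈ₗ L →
                     Misses c (leaf g) b → Misses c (leaf h) b → leaf g ≡ leaf h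
          busy     : ∀ {g b} → g ∈ₗ L → Misses c (leaf g) b → ¬ Misses c a b

      leaf≢centre : ∀ {L g} → Fan c L → g ∈ₗ L → leaf g ≢ a
      leaf≢centre F g∈ = ≢-sym (opposite≢ (centre∈ F g∈))

      -- `a` meets the blank `f` and so misses at least `μ` colours; `f` itself witnesses `1 ≤ μ`.
      some-missing : ∃[ b ] Misses c a b
      some-missing = pick (missing c a) (ℕₚ.≤-trans 1≤μ (μ≤missing c (f , a∈f , cf≡0)))
                          (∈-filter-allFin⁻ (misses? c a))
        where
        pick : ∀ xs → 1 ≤ length xs → (∀ {b} → b ∈ₗ xs → Misses c a b) → ∃[ b ] Misses c a b
        pick (b ∷ _) _ ms = b , ms (here refl)
        1≤μ : 1 ≤ μ
        1≤μ = ℕₚ.≤-trans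
          (unique-⊆⇒length≤ {xs = f ∷ []} {ys = between a (leaf f)} ([] ∷ [])
            λ { (here refl) → ∈-filter-allFin⁺ (λ e → joins? e a (leaf f)) (joins-opposite a∈f) })
          (multiplicity≤ a (leaf f))

      -- If all colours missing at leaves lay on fan edges, then these and the blank of `f` would be
      -- distinct colours on `L`, so `length Bs < length L`. But each leaf ends at most `μ` fan
      -- edges and misses at least `μ` colours, so `length L ≤ length Bs`.
      ¬closed : ∀ {L} → Elementary L → ¬ (∀ {g b} → g ∈ₗ L → Misses c (leaf g) b → ∃[ h ] h ∈ₗ L × c h ≡ b)
      ¬closed {L} El cl = ℕₚ.<⇒≱ blanks edges
        where
        open Elementary El
        leaves : List V
        leaves = deduplicate _≟_ (map leaf L)
        leaf∈ : ∀ {g} → g ∈ₗ L → leaf g ∈ₗ leaves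
        leaf∈ g∈ = ∈-deduplicate⁺ _≟_ (∈-map⁺ leaf g∈)
        leaf⁻ : ∀ {ℓ} → ℓ ∈ₗ leaves → ∃[ g ] g ∈ₗ L × ℓ ≡ leaf g
        leaf⁻ ℓ∈ = ∈-map⁻ leaf (∈-deduplicate⁻ _≟_ (map leaf L) ℓ∈)
        Bs : List Colour
        Bs = concatMap (missing c) leaves
        missing⁻ : ∀ {v b} → b ∈ₗ missing c v → Misses c v b
        missing⁻ {v} = ∈-filter-allFin⁻ (misses? c v)
        apart : ∀ {ℓ ℓ′ b} → ℓ ∈ₗ leaves → ℓ′ ∈ₗ leaves → b ∈ₗ missing c ℓ → b ∈ₗ missing c ℓ′ → ℓ ≡ ℓ′
        apart ℓ∈ ℓ′∈ b∈ b∈′ with leaf⁻ ℓ∈ | leaf⁻ ℓ′∈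
        ... | _ , g∈ , refl | _ , h∈ , refl = disjoint g∈ h∈ (missing⁻ b∈) (missing⁻ b∈′)
        Bs⁻ : ∀ {b} → b ∈ₗ Bs → ∃[ g ] g ∈ₗ L × Misses c (leaf g) b
        Bs⁻ b∈ with ∈-concatMap⁻ (missing c) leaves b∈
        ... | _ , ℓ∈ , b∈ℓ with leaf⁻ ℓ∈
        ... | g , g∈ , refl = g , g∈ , missing⁻ b∈ℓ
        used : ∀ {b} → b ∈ₗ zero ∷ Bs → b ∈ₗ map c L
        used (here refl) = subst (_∈ₗ map c L) cf≡0 (∈-map⁺ c (root∈ fan))
        used (there b∈) with Bs⁻ b∈
        ... | g , g∈ , ms with cl g∈ ms
        ... | h , h∈ , refl = ∈-map⁺ c h∈
        blanks : length Bs < length L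
        blanks = subst (length (zero ∷ Bs) ≤_) (length-map c L) (unique-⊆⇒length≤
          (All.tabulate (λ b∈ p → proj₁ (proj₂ (proj₂ (Bs⁻ b∈))) (sym p)) ∷
           unique-concatMap (missing c) (DecUniqueₚ.deduplicate-! _≟_ (map leaf L))
             (λ {v} _ → unique-filter (misses? c v)) apart)
          used)
        edges : length L ≤ length Bs
        edges = ℕₚ.≤-trans
          (unique-⊆⇒length≤ (fan-unique fan) λ {g} g∈ → ∈-concatMap⁺ (between a) (leaf∈ g∈)
            (∈-filter-allFin⁺ (λ e → joins? e a (leaf g)) (joins-opposite (centre∈ fan g∈))))
          (length-concatMap-mono (between a) (missing c) leaves λ {ℓ} ℓ∈ →
            ℕₚ.≤-trans (multiplicity≤ a ℓ) (enoughAt ℓ∈))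
          where
          enoughAt : ∀ {ℓ} → ℓ ∈ₗ leaves → μ ≤ length (missing c ℓ)
          enoughAt ℓ∈ with leaf⁻ ℓ∈
          ... | _ , g∈ , refl = μ≤missing c (covered g∈)

    -- Take the oldest fan edge at this leaf: its tail `T` avoids the leaf, so nothing in the fan up
    -- to it depends on the colours missing there.
    first : ∀ {c L g} → Fan c L → g ∈ₗ L →
      ∃[ h ] ∃[ T ] Fan c (h ∷ T) × leaf h ≡ leaf g
        × (∀ {p} → p ∈ₗ T → leaf p ≢ leaf g) × (∀ {p} → p ∈ₗ T → p ∈ₗ L)
    first root (here refl) = f , [] , root , refl , (λ ()) , λ ()
    first {L = _ ∷ L} {g} F@(grow F₀ _ _ _ _) g∈ with Any.any? (λ p → leaf p ≟ leaf g) L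
    ... | yes earlier = let p , p∈ , q = find earlier
                            h , T , F₁ , r , new , sub = first F₀ p∈
                        in h , T , F₁ , trans r q , (λ t∈ s → new t∈ (trans s (sym q))) , there ∘ sub
    ... | no none with g∈
    ...   | here refl = g , L , F , refl , (λ p∈ q → none (lose p∈ q)) , there
    ...   | there p   = ⊥-elim (none (lose p refl))

    -- The newest edge supports nothing yet, so missing colours need to persist only at leaves of
    -- the tail `T`.
    transport : ∀ {c c′ h T} → (∀ {e} → a ∈ᵉ e → c′ e ≡ c e) → Fan c (h ∷ T) →
      (∀ {g e} → g ∈ₗ T → a ∈ᵉ e → Misses c (leaf g) (c e) → Misses c′ (leaf g) (c e)) → Fan c′ (h ∷ T)
    transport same root ok = root
    transport {c} {c′} {h} same (grow {L = y ∷ T} {g} F g∈ a∈h h∉ ms) ok =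
      grow (transport same F (λ p → ok (there p))) g∈ a∈h h∉
           (subst (Misses c′ (leaf g)) (sym (same a∈h)) (ok g∈ a∈h ms))

    -- Growing a fan until one of the two outcomes appears.

    module _ {c : Colouring} (pc : Proper c) (cf≡0 : c f ≡ zero) where

      -- Of the two leaves missing b only one can share the Kempe component of the centre;
      -- swapping outside that component lets the other one (or the earlier, if possible) miss α.
      collide : ∀ {L g h b} → Elementary pc cf≡0 L → Fan c (h ∷ L) → g ∈ₗ L →
        Misses c (leaf g) b → Misses c (leaf h) b → leaf g ≢ leaf h → Filled c f
      collide {L} {g} {h} {b} El F g∈ msg msh g≢h with some-missing pc cf≡0
      ... | α , msα = result
        where
        open Elementary El
        α≢b : α ≢ b
        α≢b refl = busy g∈ msg msα
        open Kempe pc (proj₁ msα) (proj₁ msg) α≢b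
        K : Component a
        K = component msα
        open Component K using (members) renaming (root∈ to a∈K)
        open Swap K
        lift : Filled recoloured f → Filled c f
        lift r = record
          { colouring = colouring ; proper = proper ; filled = filled
          ; blank⁺ = λ e≢f p → blank⁺′ e≢f (blank⁺ p)
          ; blank⁻ = λ p → blank⁻ (blank⁻′ p) }
          where open Filled r renaming (blank⁺ to blank⁺′; blank⁻ to blank⁻′)
        finish′ : ∀ {h′ T} → Fan c (h′ ∷ T) → Misses c (leaf h′) b → leaf h′ ∉ₗ members →
          (∀ {p} → p ∈ₗ T → p ∈ₗ L) → (∀ {p} → p ∈ₗ T → Misses c (leaf p) b → leaf p ∈ₗ members) → Filled c f
        finish′ {h′} {T} F′ ms ∉K sub safe = lift (complete recoloured-proper (blank⁺ cf≡0)
          (transport (inside a∈K) F′ ok) (here refl)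
          (misses-outside ∉K ms) (misses-inside a∈K msα))
          where
          -- A colour at `a` is never α. If it is `b`, then `safe` puts the leaf inside the
          -- component, where nothing changes.
          ok : ∀ {p e} → p ∈ₗ T → a ∈ᵉ e → Misses c (leaf p) (c e) → Misses recoloured (leaf p) (c e)
          ok {p} {e} p∈ a∈e msp with c e ≟ b
          ... | yes q = misses-inside (safe p∈ (subst (Misses c (leaf p)) q msp)) msp
          ... | no ≢b = misses-other (proj₂ msα e a∈e) ≢b msp
        result : Filled c f
        result with leaf g ∈ˡ? members
        ... | yes g∈K = finish′ F msh
                (λ h∈K → g≢h (at-most-one (leaf≢centre pc cf≡0 fan g∈) (leaf≢centre pc cf≡0 F (here refl)) msg msh g∈K h∈K))
                id (λ p∈ ms → subst (_∈ₗ members) (disjoint g∈ p∈ msg ms) g∈K)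
        ... | no g∉K with first fan g∈
        ...   | h′ , T , F′ , q , new , sub = finish′ F′ (subst (λ v → Misses c v b) (sym q) msg)
                (subst (_∉ₗ members) (sym q) g∉K) sub
                (λ p∈ ms → ⊥-elim (new p∈ (disjoint (sub p∈) g∈ ms msg)))

      Outcome : Set
      Outcome = Filled c f ⊎ Moved c a f

      extend : ∀ {L h} → Elementary pc cf≡0 L → Fan c (h ∷ L) → Outcome ⊎ Elementary pc cf≡0 (h ∷ L)
      extend {L} {h} El F with covered? c (leaf h)
      ... | no ¬cov = inj₁ (inj₂ (move pc cf≡0 F (here refl) ¬cov))
      ... | yes cov with any? (λ b → misses? c (leaf h) b ×-dec misses? c a b)
      ...   | yes (b , ms , msa) = inj₁ (inj₁ (complete pc cf≡0 F (here refl) ms msa))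
      ...   | no ¬free with any? (λ g → (g ∈ˡ? L) ×-dec (¬? (leaf g ≟ leaf h) ×-dec
                               any? (λ b → misses? c (leaf g) b ×-dec misses? c (leaf h) b)))
      ...     | yes (g , g∈ , ≢ , b , msg , msh) = inj₁ (inj₁ (collide El F g∈ msg msh ≢))
      ...     | no ¬clash = inj₂ record
                { fan = F
                ; covered = λ { (here refl) → cov ; (there p) → covered p }
                ; disjoint = dj
                ; busy = λ { (here refl) ms msa → ¬free (_ , ms , msa) ; (there p) → busy p } }
        where
        open Elementary El
        clash : ∀ {g b} → g ∈ₗ L → Misses c (leaf g) b → Misses c (leaf h) b → leaf g ≡ leaf h
        clash {g} g∈ msg msh = decidable-stable (leaf g ≟ leaf h) λ ≢ → ¬clash (g , g∈ , ≢ , _ , msg , msh)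
        dj : ∀ {g g′ b} → g ∈ₗ h ∷ L → g′ ∈ₗ h ∷ L →
          Misses c (leaf g) b → Misses c (leaf g′) b → leaf g ≡ leaf g′
        dj (here refl) (here refl) _ _  = refl
        dj (here refl) (there p)   m m′ = sym (clash p m′ m)
        dj (there p)   (here refl) m m′ = clash p m m′
        dj (there p)   (there q)   m m′ = disjoint p q m m′

      -- Fan edges are distinct, so `m` bounds their number. If no edge can be added, then by `busy`
      -- each colour missing at a leaf is on an edge at `a`, which must already be in the fan,
      -- against `¬closed`.
      exhaust : ∀ d {L} → Elementary pc cf≡0 L → m < d + length L → Outcome
      exhaust zero El lt = ⊥-elim (ℕₚ.<⇒≱ lt (unique⇒length≤ (fan-unique (Elementary.fan El))))
      exhaust (suc d) {L} El lt
        with any? (λ h → (a ∈ᵉ? h) ×-dec (¬? (h ∈ˡ? L) ×-dec any? (λ g → (g ∈ˡ? L) ×-dec misses? c (leaf g) (c h))))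
      ... | yes (h , a∈h , h∉ , g , g∈ , ms) with extend El (grow (Elementary.fan El) g∈ a∈h h∉ ms)
      ...   | inj₁ o   = o
      ...   | inj₂ El′ = exhaust d El′ (subst (m <_) (sym (ℕₚ.+-suc d _)) lt)
      exhaust (suc d) {L} El lt | no ¬more = ⊥-elim (¬closed pc cf≡0 El λ {g} g∈ ms →
        let h , a∈h , p = ¬misses⇒has c a (proj₁ ms) (Elementary.busy El g∈ ms)
        in h , decidable-stable (h ∈ˡ? L) (λ h∉ → ¬more (h , a∈h , h∉ , g , g∈ , subst (Misses c (leaf g)) (sym p) ms)) , p)

      fill-or-move : Outcome
      fill-or-move with any? (λ b → misses? c (leaf f) b ×-dec misses? c a b)
      ... | yes (b , ms , msa) = inj₁ (complete pc cf≡0 root (here refl) ms msa)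
      ... | no ¬free = exhaust m {f ∷ []} (record
        { fan = root
        ; covered = λ { (here refl) → f , opposite∈ a∈f , cf≡0 }
        ; disjoint = λ { (here refl) (here refl) _ _ → refl }
        ; busy = λ { (here refl) ms msa → ¬free (_ , ms , msa) } }) (ℕₚ.m<m+n m (s≤s z≤n))

-- The precoloured set: distances and pentagons.

module Extension {n m : ℕ} (G : Multigraph n m) (k D μ : ℕ)
  (degree≤ : ∀ v → degree G v ≤ D) (multiplicity≤ : ∀ u v → multiplicity G u v ≤ μ)
  (enough : D + μ ≡ suc k) (noC5 : ¬ HasC5 G) (M : Subset m)
  (far : ∀ e f → e ∈ M → f ∈ M → e ≢ f → EdgeDistAtLeast5 G e f)
  (φ : Fin m → Fin (suc k)) where
  open VizingFan G k D μ degree≤ multiplicity≤ enough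

  -- A bound on the length, rather than its value, lets `via` also cross an edge whose two named
  -- ends coincide.
  Within : ℕ → V → V → Set
  Within d x y = ∃[ j ] j ≤ d × Walk G x y j

  stay : ∀ {x} → Within 0 x x
  stay = 0 , z≤n , here

  via : ∀ {d x y z} (e : E) → x ∈ᵉ e → y ∈ᵉ e → Within d y z → Within (suc d) x z
  via {x = x} {y} e x∈e y∈e (j , j≤d , w) with x ≟ y
  ... | yes refl = j , ℕₚ.m≤n⇒m≤1+n j≤d , w
  ... | no x≢y   = suc j , s≤s j≤d , step (e , ∈∈⇒joins x∈e y∈e x≢y) w

  near⇒≡ : ∀ {e f x y d} → e ∈ M → f ∈ M → x ∈ᵉ e → y ∈ᵉ f → Within d x y → d ≤ 4 → e ≡ f
  near⇒≡ {e} {f} {x} {y} e∈M f∈M x∈e y∈f (j , j≤d , w) d≤4 = decidable-stable (e ≟ f) λ e≢f →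
    far e f e∈M f∈M e≢f (x , y , j , x∈e , y∈f , ℕₚ.≤-trans j≤d d≤4 , w)

  -- Consecutive vertices differ because there are no loops, so only the five diagonals need
  -- checking.
  ¬pentagon : ∀ {p q r s t} →
    Adjacent G p q → Adjacent G q r → Adjacent G r s → Adjacent G s t → Adjacent G t p →
    p ≢ r → p ≢ s → q ≢ s → q ≢ t → r ≢ t → ⊥
  ¬pentagon {p} {q} {r} {s} {t} pq qr rs st tp p≢r p≢s q≢s q≢t r≢t =
    noC5 (lookup vertices , UniqueVecₚ.lookup-injective distinct _ _ , pq , qr , rs , st , tp)
    where
    adj≢ : ∀ {u v} → Adjacent G u v → u ≢ v
    adj≢ (_ , j) = joins⇒≢ j
    vertices : Vec V 5
    vertices = p ∷ᵛ q ∷ᵛ r ∷ᵛ s ∷ᵛ t ∷ᵛ []ᵛ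
    distinct : UniqueVec.Unique vertices
    distinct = (adj≢ pq ∷ᵃ p≢r ∷ᵃ p≢s ∷ᵃ ≢-sym (adj≢ tp) ∷ᵃ []ᵃ)
            ∷ᵖ (adj≢ qr ∷ᵃ q≢s ∷ᵃ q≢t ∷ᵃ []ᵃ) ∷ᵖ (adj≢ rs ∷ᵃ r≢t ∷ᵃ []ᵃ) ∷ᵖ (adj≢ st ∷ᵃ []ᵃ) ∷ᵖ []ᵃ ∷ᵖ []ᵖ

  -- Making the blank edges a matching.

  blankEdges : Colouring → List E
  blankEdges c = filter (λ e → c e ≟ zero) (allFin m)

  blankEdges⁺ : ∀ c {e} → c e ≡ zero → e ∈ₗ blankEdges c
  blankEdges⁺ c = ∈-filter-allFin⁺ (λ e → c e ≟ zero)

  blankEdges⁻ : ∀ c {e} → e ∈ₗ blankEdges c → c e ≡ zero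
  blankEdges⁻ c = ∈-filter-allFin⁻ (λ e → c e ≟ zero)

  blankEdges-unique : ∀ c → Unique (blankEdges c)
  blankEdges-unique c = unique-filter (λ e → c e ≟ zero)

  -- `z` is only a bound, so moving a blank keeps it valid; filling an edge outside `M` allows a
  -- smaller one.
  record State (z : ℕ) (c : Colouring) : Set where
    field
      proper : Proper c
      blankM : ∀ {e} → e ∈ M → c e ≡ zero
      few    : length (blankEdges c) ≤ z

  Better : ℕ → Set
  Better z = ∃[ c ] ∃[ y ] y < z × State y c

  Matching : Colouring → Set
  Matching c = ∀ {e f v} → v ∈ᵉ e → v ∈ᵉ f → c e ≡ zero → c f ≡ zero → e ≡ f

  ∉⇒≢ : ∀ {f} → f ∉ M → ∀ {e} → e ∈ M → e ≢ f
  ∉⇒≢ f∉M e∈M refl = f∉M e∈M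

  filled⇒better : ∀ {z c f} → State z c → c f ≡ zero → f ∉ M → Filled c f → Better z
  filled⇒better {z} {c} {f} S cf≡0 f∉M F =
    colouring , length (blankEdges colouring) , ℕₚ.≤-trans fewer few , record
      { proper = Filled.proper F ; blankM = λ e∈M → blank⁺ (∉⇒≢ f∉M e∈M) (blankM e∈M) ; few = ℕₚ.≤-refl }
    where
    open State S
    open Filled F using (colouring; filled; blank⁺; blank⁻)
    fewer : length (f ∷ blankEdges colouring) ≤ length (blankEdges c)
    fewer = unique-⊆⇒length≤
      (All.tabulate (λ e∈ f≡e → filled (trans (cong colouring f≡e) (blankEdges⁻ colouring e∈)))
        ∷ blankEdges-unique colouring)
      λ { (here refl) → blankEdges⁺ c cf≡0 ; (there e∈) → blankEdges⁺ c (blank⁻ (blankEdges⁻ colouring e∈)) }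

  moved⇒state : ∀ {z c a f} → State z c → c f ≡ zero → f ∉ M → (R : Moved c a f) → State z (Moved.colouring R)
  moved⇒state {z} {c} {a} {f} S cf≡0 f∉M R = record
    { proper = Moved.proper R
    ; blankM = λ e∈M → blank⁺ (∉⇒≢ f∉M e∈M) (blankM e∈M)
    ; few = ℕₚ.≤-trans (ℕₚ.≤-pred fewer) few }
    where
    open State S
    open Moved R using (colouring; filled; target; blank⁺; blank⁻)
    fewer : length (f ∷ blankEdges colouring) ≤ length (target ∷ blankEdges c)
    fewer = unique-⊆⇒length≤
      (All.tabulate (λ e∈ f≡e → filled (trans (cong colouring f≡e) (blankEdges⁻ colouring e∈)))
        ∷ blankEdges-unique colouring) inc
      where
      inc : ∀ {e} → e ∈ₗ f ∷ blankEdges colouring → e ∈ₗ target ∷ blankEdges c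
      inc (here refl) = there (blankEdges⁺ c cf≡0)
      inc {e} (there e∈) with e ≟ target
      ... | yes p = here p
      ... | no ¬p = there (blankEdges⁺ c (blank⁻ (blankEdges⁻ colouring e∈) ¬p))

  uncoveredVertices : Colouring → List V
  uncoveredVertices c = filter (λ v → ¬? (covered? c v)) (allFin n)

  -- Two blank edges f, f′ meet at v and f ∉ M: a fan around the other end of f moves the blank
  -- away from v to a vertex uncovered so far, so one more vertex becomes covered.
  disperse : ∀ {z c f f′ v} → State z c → v ∈ᵉ f → v ∈ᵉ f′ → f ≢ f′ → c f ≡ zero → c f′ ≡ zero → f ∉ M →
    Better z ⊎ ∃[ c′ ] State z c′ × length (uncoveredVertices c′) < length (uncoveredVertices c)
  disperse {z} {c} {f} {f′} {v} S v∈f v∈f′ f≢f′ cf≡0 cf′≡0 f∉M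
    with fill-or-move (opposite∈ v∈f) (State.proper S) cf≡0
  ... | inj₁ F = inj₁ (filled⇒better S cf≡0 f∉M F)
  ... | inj₂ R = inj₂ (colouring , moved⇒state S cf≡0 f∉M R , fewer)
    where
    open Moved R using (colouring; target; a∈target; emptied; blank⁺) renaming (uncovered to ¬covered)
    b s : V
    b = opposite v f
    s = opposite b target
    unc⁻ : ∀ c {v} → v ∈ₗ uncoveredVertices c → ¬ Covered c v
    unc⁻ c = ∈-filter-allFin⁻ (λ v → ¬? (covered? c v))
    keep : ∀ {w} → Covered c w → Covered colouring w
    keep {w} (e , w∈e , p) with e ≟ f
    ... | no e≢f = e , w∈e , blank⁺ e≢f p
    ... | yes refl with ∈-opposite v∈f w∈e
    ...   | inj₁ refl = f′ , v∈f′ , blank⁺ (≢-sym f≢f′) cf′≡0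
    ...   | inj₂ refl = target , a∈target , emptied
    fewer : length (s ∷ uncoveredVertices colouring) ≤ length (uncoveredVertices c)
    fewer = unique-⊆⇒length≤
      (All.tabulate (λ w∈ s≡w → unc⁻ colouring w∈
          (target , subst (_∈ᵉ target) s≡w (opposite∈ a∈target) , emptied))
        ∷ unique-filter (λ v → ¬? (covered? colouring v)))
      λ { (here refl) → ∈-filter-allFin⁺ (λ v → ¬? (covered? c v)) ¬covered
        ; (there w∈) → ∈-filter-allFin⁺ (λ v → ¬? (covered? c v)) (unc⁻ colouring w∈ ∘ keep) }

  Clash : Colouring → Set
  Clash c = ∃[ e ] ∃[ f ] ∃[ v ] e ≢ f × v ∈ᵉ e × v ∈ᵉ f × c e ≡ zero × c f ≡ zero

  clash? : ∀ c → Dec (Clash c)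
  clash? c = any? λ e → any? λ f → any? λ v →
    ¬? (e ≟ f) ×-dec (v ∈ᵉ? e) ×-dec (v ∈ᵉ? f) ×-dec (c e ≟ zero) ×-dec (c f ≟ zero)

  -- Two meeting blank edges cannot both lie in `M`, so one can be dispersed, and each dispersal
  -- lowers the number of uncovered vertices.
  match : ∀ {z c} → State z c → Acc _<_ (length (uncoveredVertices c)) →
    Better z ⊎ ∃[ c′ ] State z c′ × Matching c′
  match {z} {c} S (acc rs) with clash? c
  ... | no ¬clash = inj₂ (c , S , λ {e} {f} v∈e v∈f p q →
          decidable-stable (e ≟ f) λ e≢f → ¬clash (e , f , _ , e≢f , v∈e , v∈f , p , q))
  ... | yes (e , f , v , e≢f , v∈e , v∈f , p , q) = continue one
    where
    Step : Set
    Step = Better z ⊎ ∃[ c′ ] State z c′ × length (uncoveredVertices c′) < length (uncoveredVertices c)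
    one : Step
    one with e ∈? M | f ∈? M
    ... | no e∉M | _       = disperse S v∈e v∈f e≢f p q e∉M
    ... | yes _  | no f∉M  = disperse S v∈f v∈e (≢-sym e≢f) q p f∉M
    ... | yes e∈M | yes f∈M = ⊥-elim (e≢f (near⇒≡ e∈M f∈M v∈e v∈f stay z≤n))
    continue : Step → Better z ⊎ ∃[ c′ ] State z c′ × Matching c′
    continue (inj₁ b)             = inj₁ b
    continue (inj₂ (c′ , S′ , lt)) = match S′ (rs lt)

  -- Removing obstructions around the edges of `M`.

  record Tidy (z : ℕ) (c : Colouring) : Set where
    field
      state    : State z c
      matching : Matching c
    open State state public

  -- `f` would have to become blank for the sake of `e`, yet meets a blank `g` outside `M`. As `φ e`
  -- may itself be zero, `c f ≢ zero` keeps blank edges from counting as `f`.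
  Obstructed : Colouring → E → V → Set
  Obstructed c e u = ∃[ f ] u ∈ᵉ f × c f ≡ φ e × c f ≢ zero ×
    (∃[ x ] ∃[ g ] x ∈ᵉ f × x ∈ᵉ g × c g ≡ zero × g ∉ M)

  obstructed? : ∀ c e u → Dec (Obstructed c e u)
  obstructed? c e u = any? λ f → (u ∈ᵉ? f) ×-dec (c f ≟ φ e) ×-dec ¬? (c f ≟ zero) ×-dec
    (any? λ x → any? λ g → (x ∈ᵉ? f) ×-dec (x ∈ᵉ? g) ×-dec (c g ≟ zero) ×-dec ¬? (g ∈? M))

  -- Stronger than being unobstructed: an end without an edge of colour `φ e` may acquire one in a
  -- later fan, whereas readiness survives work at the other end of `e`.
  Ready : Colouring → E → V → Set
  Ready c e u = ∃[ f ] u ∈ᵉ f × c f ≡ φ e × c f ≢ zero ×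
    (∀ {x g} → x ∈ᵉ f → x ∈ᵉ g → c g ≡ zero → g ∈ M)

  ready⇒¬obstructed : ∀ {c e u} → Proper c → Ready c e u → ¬ Obstructed c e u
  ready⇒¬obstructed pc (f , u∈f , p , ≢0 , ok) (f′ , u∈f′ , p′ , _ , x , g , x∈f′ , x∈g , q , g∉M)
    with pc u∈f u∈f′ (trans p (sym p′)) ≢0
  ... | refl = g∉M (ok x∈f′ x∈g q)

  record Improved (z : ℕ) (c : Colouring) (e : E) (u : V) : Set where
    field
      colouring : Colouring
      tidy      : Tidy z colouring
      ready     : Ready colouring e u
      keeps     : ∀ {v} → v ∈ᵉ e → v ≢ u → Ready c e v → Ready colouring e v
      harmless  : ∀ {e′ v} → e′ ∈ M → e′ ≢ e → v ∈ᵉ e′ → Obstructed colouring e′ v → Obstructed c e′ v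

  -- The blank at x = the other end of f is moved by a fan around its far end w.  The new blank wℓ
  -- stays clear of the other edges of M because they are far away, and of the other end of e
  -- because u x w ℓ v would be a pentagon.
  improve : ∀ {z c e u} → Tidy z c → e ∈ M → u ∈ᵉ e → Obstructed c e u → Better z ⊎ Improved z c e u
  improve {z} {c} {e} {u} T e∈M u∈e (f , u∈f , cf≡φ , cf≢0 , x , g , x∈f , x∈g , cg≡0 , g∉M)
    with fill-or-move (opposite∈ x∈g) (Tidy.proper T) cg≡0
  ... | inj₁ F = inj₁ (filled⇒better (Tidy.state T) cg≡0 g∉M F)
  ... | inj₂ R = inj₂ record
    { colouring = c′ ; tidy = record { state = moved⇒state state cg≡0 g∉M R ; matching = matching′ }
    ; ready = f , u∈f , trans (local w∉f) cf≡φ , (λ p → cf≢0 (trans (sym (local w∉f)) p)) , clear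
    ; keeps = keeps ; harmless = harmless }
    where
    open Tidy T
    open Moved R renaming (colouring to c′; target to h; a∈target to w∈h) hiding (proper)
    w ℓ : V
    w = opposite x g
    ℓ = opposite w h
    w∈g = opposite∈ x∈g
    ℓ∈h = opposite∈ w∈h
    ce≡0 = blankM e∈M
    g≢e : g ≢ e
    g≢e p = ∉⇒≢ g∉M e∈M (sym p)
    end∉e : ∀ {v} → v ∈ᵉ g → ¬ v ∈ᵉ e
    end∉e v∈g v∈e = g≢e (matching v∈g v∈e cg≡0 ce≡0)
    ℓ≢ : ∀ {v e′} → v ∈ᵉ e′ → c e′ ≡ zero → v ≢ ℓ
    ℓ≢ v∈ p refl = uncovered (_ , v∈ , p)
    u≢x : u ≢ x
    u≢x refl = end∉e x∈g u∈e
    u≢w : u ≢ w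
    u≢w refl = end∉e w∈g u∈e
    only-f : ∀ {v} → v ∈ᵉ f → v ≡ u ⊎ v ≡ x
    only-f = joins-only (∈∈⇒joins u∈f x∈f u≢x)
    w∉f : ¬ w ∈ᵉ f
    w∉f w∈f = [ (λ p → u≢w (sym p)) , (λ p → opposite≢ x∈g (sym p)) ]′ (only-f w∈f)
    only-h : ∀ {v} → v ∈ᵉ h → v ≡ w ⊎ v ≡ ℓ
    only-h = ∈-opposite w∈h
    old : ∀ {e′} → c′ e′ ≡ zero → e′ ≡ h ⊎ (e′ ≢ g × c e′ ≡ zero)
    old {e′} p with e′ ≟ h
    ... | yes q = inj₁ q
    ... | no ¬q = inj₂ ((λ { refl → filled p }) , blank⁻ p ¬q)
    -- `h` meets no old blank but `g`: at `w` by the matching property, at `ℓ` because `ℓ` was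
    -- uncovered.
    fresh : ∀ {v e′} → v ∈ᵉ h → v ∈ᵉ e′ → e′ ≢ g → c e′ ≡ zero → ⊥
    fresh v∈h v∈e′ e′≢g p with only-h v∈h
    ... | inj₁ refl = e′≢g (matching v∈e′ w∈g p cg≡0)
    ... | inj₂ refl = uncovered (_ , v∈e′ , p)
    matching′ : Matching c′
    matching′ v∈e₁ v∈e₂ p q with old p | old q
    ... | inj₁ refl | inj₁ refl       = refl
    ... | inj₁ refl | inj₂ (≢g , q′)  = ⊥-elim (fresh v∈e₁ v∈e₂ ≢g q′)
    ... | inj₂ (≢g , p′) | inj₁ refl  = ⊥-elim (fresh v∈e₂ v∈e₁ ≢g p′)
    ... | inj₂ (_ , p′) | inj₂ (_ , q′) = matching v∈e₁ v∈e₂ p′ q′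
    clear : ∀ {y g′} → y ∈ᵉ f → y ∈ᵉ g′ → c′ g′ ≡ zero → g′ ∈ M
    clear y∈f y∈g′ p with old p | only-f y∈f
    ... | inj₁ refl | inj₁ refl = [ ⊥-elim ∘ u≢w , ⊥-elim ∘ ℓ≢ u∈e ce≡0 ]′ (only-h y∈g′)
    ... | inj₁ refl | inj₂ refl = [ ⊥-elim ∘ opposite≢ x∈g , ⊥-elim ∘ ℓ≢ x∈g cg≡0 ]′ (only-h y∈g′)
    ... | inj₂ (_ , q)  | inj₁ refl = subst (_∈ M) (matching u∈e y∈g′ ce≡0 q) e∈M
    ... | inj₂ (≢g , q) | inj₂ refl = ⊥-elim (≢g (matching y∈g′ x∈g q cg≡0))
    keeps : ∀ {v} → v ∈ᵉ e → v ≢ u → Ready c e v → Ready c′ e v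
    keeps {v} v∈e v≢u (f₁ , v∈f₁ , p , ≢0 , ok) =
      f₁ , v∈f₁ , trans (local w∉f₁) p , (λ q → ≢0 (trans (sym (local w∉f₁)) q)) , ok′
      where
      w∉f₁ : ¬ w ∈ᵉ f₁
      -- Readiness leaves no blank outside `M` at `f₁`, so `f₁` avoids `w` and keeps its colour.
      w∉f₁ w∈f₁ = g∉M (ok w∈f₁ w∈g cg≡0)
      v≢ℓ : v ≢ ℓ
      v≢ℓ = ℓ≢ v∈e ce≡0
      ok′ : ∀ {y g′} → y ∈ᵉ f₁ → y ∈ᵉ g′ → c′ g′ ≡ zero → g′ ∈ M
      ok′ y∈f₁ y∈g′ q with old q
      ... | inj₂ (_ , q′) = ok y∈f₁ y∈g′ q′
      ... | inj₁ refl with only-h y∈g′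
      ...   | inj₁ refl = ⊥-elim (w∉f₁ y∈f₁)
      -- Now `f₁` joins `ℓ` to `v` and closes the 5-cycle.
      ...   | inj₂ refl = ⊥-elim (¬pentagon
                (f , ∈∈⇒joins u∈f x∈f u≢x) (g , joins-opposite x∈g) (h , joins-opposite w∈h)
                (f₁ , ∈∈⇒joins y∈f₁ v∈f₁ (≢-sym v≢ℓ)) (e , ∈∈⇒joins v∈e u∈e v≢u)
                u≢w (ℓ≢ u∈e ce≡0) (ℓ≢ x∈g cg≡0)
                (λ { refl → end∉e x∈g v∈e }) (λ { refl → end∉e w∈g v∈e }))
    harmless : ∀ {e′ v} → e′ ∈ M → e′ ≢ e → v ∈ᵉ e′ → Obstructed c′ e′ v → Obstructed c e′ v
    harmless {e′} {v} e′∈M e′≢e v∈e′ (f₁ , v∈f₁ , p , ≢0 , y , g₁ , y∈f₁ , y∈g₁ , q , g₁∉M) =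
      f₁ , v∈f₁ , trans (sym (local w∉f₁)) p , (λ r → ≢0 (trans (local w∉f₁) r)) ,
      y , g₁ , y∈f₁ , y∈g₁ , blank , g₁∉M
      where
      w∉f₁ : ¬ w ∈ᵉ f₁
      w∉f₁ w∈f₁ = e′≢e (sym (near⇒≡ e∈M e′∈M u∈e v∈e′
        (via f u∈f x∈f (via g x∈g w∈g (via f₁ w∈f₁ v∈f₁ stay))) (s≤s (s≤s (s≤s z≤n)))))
      blank : c g₁ ≡ zero
      blank with old q
      ... | inj₂ (_ , q′) = q′
      ... | inj₁ refl with only-h y∈g₁
      ...   | inj₁ refl = ⊥-elim (w∉f₁ y∈f₁)
      -- The walk along `f`, `g`, `h` and `f₁` may need four edges: here the full distance
      -- hypothesis is used.
      ...   | inj₂ refl = ⊥-elim (e′≢e (sym (near⇒≡ e∈M e′∈M u∈e v∈e′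
                (via f u∈f x∈f (via g x∈g w∈g (via h w∈h ℓ∈h (via f₁ y∈f₁ v∈f₁ stay)))) ℕₚ.≤-refl)))

  Settled : Colouring → E → Set
  Settled c e = ∀ {v} → v ∈ᵉ e → ¬ Obstructed c e v

  record Settling (z : ℕ) (c : Colouring) (e : E) : Set where
    field
      colouring : Colouring
      tidy      : Tidy z colouring
      settled   : Settled colouring e
      harmless  : ∀ {e′ v} → e′ ∈ M → e′ ≢ e → v ∈ᵉ e′ → Obstructed colouring e′ v → Obstructed c e′ v

  -- A step at one end of e may obstruct the other end only if that end was not ready, so two
  -- steps suffice.
  settleFrom : ∀ {z c e p q} → e ∈ M → Joins G e p q → Tidy z c → Obstructed c e p → Better z ⊎ Settling z c e
  settleFrom {z} {c} {e} {p} {q} e∈M pq T ob with improve T e∈M (joins⇒∈ˡ pq) ob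
  ... | inj₁ b = inj₁ b
  ... | inj₂ I with obstructed? (Improved.colouring I) e q
  ...   | no ¬ob = inj₂ record
          { colouring = colouring ; tidy = tidy ; harmless = harmless
          ; settled = λ v∈e → [ (λ { refl → ready⇒¬obstructed (Tidy.proper tidy) ready }) , (λ { refl → ¬ob }) ]′
                                (joins-only pq v∈e) }
    where open Improved I
  ...   | yes ob′ with improve (Improved.tidy I) e∈M (joins⇒∈ʳ pq) ob′
  ...     | inj₁ b = inj₁ b
  ...     | inj₂ J = inj₂ record
            { colouring = Improved.colouring J ; tidy = Improved.tidy J
            ; harmless = λ e′∈M ≢e v∈ → Improved.harmless I e′∈M ≢e v∈ ∘ Improved.harmless J e′∈M ≢e v∈
            ; settled = λ v∈e → ready⇒¬obstructed (Tidy.proper (Improved.tidy J))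
                ([ (λ { refl → Improved.keeps J (joins⇒∈ˡ pq) (joins⇒≢ pq) (Improved.ready I) })
                 , (λ { refl → Improved.ready J }) ]′ (joins-only pq v∈e)) }

  settle : ∀ {z c} e → e ∈ M → Tidy z c → Better z ⊎ Settling z c e
  settle {z} {c} e e∈M T with obstructed? c e (proj₁ (ends e)) | obstructed? c e (proj₂ (ends e))
  ... | yes ob | _      = settleFrom e∈M (inj₁ (refl , refl)) T ob
  ... | no _   | yes ob = settleFrom e∈M (inj₂ (refl , refl)) T ob
  ... | no ¬p  | no ¬q  = inj₂ record
    { colouring = c ; tidy = T ; harmless = λ _ _ _ → id
    ; settled = λ { (inj₁ refl) → ¬p ; (inj₂ refl) → ¬q } }

  -- By `harmless`, settling one edge of `M` unsettles no other, so they can be treated in turn.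
  settleAll : ∀ {z c} (es : List E) → Tidy z c →
    Better z ⊎ ∃[ c′ ] Tidy z c′ × (∀ {e} → e ∈ₗ es → e ∈ M → Settled c′ e)
  settleAll {c = c} [] T = inj₂ (c , T , λ ())
  settleAll (e ∷ es) T with settleAll es T
  ... | inj₁ b = inj₁ b
  ... | inj₂ (c₁ , T₁ , ok) with e ∈? M
  ...   | no e∉M = inj₂ (c₁ , T₁ , λ { (here refl) e∈M → ⊥-elim (e∉M e∈M) ; (there p) → ok p })
  ...   | yes e∈M with settle e e∈M T₁
  ...     | inj₁ b = inj₁ b
  ...     | inj₂ Z = inj₂ (colouring , tidy , done)
    where
    open Settling Z
    done : ∀ {e′} → e′ ∈ₗ e ∷ es → e′ ∈ M → Settled colouring e′
    done {e′} e′∈ e′∈M with e′ ≟ e | e′∈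
    ... | yes refl | _       = settled
    ... | no ≢e    | here p  = ⊥-elim (≢e p)
    ... | no ≢e    | there p = λ v∈ → ok p e′∈M v∈ ∘ harmless e′∈M ≢e v∈

  Solution : Set
  Solution = Σ (Fin m → Fin (suc k)) λ c → IsProperEdgeColouring G c × (∀ e → e ∈ M → c e ≡ φ e)

  -- The final colouring.

  module Finish {z c} (T : Tidy z c) (settled : ∀ {e} → e ∈ M → Settled c e) where
    open Tidy T

    Yields : E → Set
    Yields f = ∃[ e ] e ∈ M × φ e ≡ c f × (∃[ v ] v ∈ᵉ e × v ∈ᵉ f)

    yields? : ∀ f → Dec (Yields f)
    yields? f = any? λ e → (e ∈? M) ×-dec (φ e ≟ c f) ×-dec (any? λ v → (v ∈ᵉ? e) ×-dec (v ∈ᵉ? f))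

    -- From here on zero is an ordinary colour: old blanks outside `M` and edges that yield to `M`
    -- both receive it.
    final : Fin m → Fin (suc k)
    final f with f ∈? M | yields? f
    ... | yes _ | _     = φ f
    ... | no  _ | yes _ = zero
    ... | no  _ | no  _ = c f

    -- A blank edge may satisfy `Yields` when some `φ e` is zero; it is then classed as `blank`, so
    -- `yielded` edges had a genuine colour.
    data View (f : E) : Set where
      given   : f ∈ M → final f ≡ φ f → View f
      blank   : f ∉ M → final f ≡ zero → c f ≡ zero → View f
      yielded : f ∉ M → final f ≡ zero → c f ≢ zero → Yields f → View f
      kept    : final f ≡ c f → c f ≢ zero → ¬ Yields f → View f

    final-M : ∀ {f} → f ∈ M → final f ≡ φ f
    final-M {f} f∈M with f ∈? M
    ... | yes _  = refl
    ... | no f∉M = ⊥-elim (f∉M f∈M)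

    final-yields : ∀ {f} → f ∉ M → Yields f → final f ≡ zero
    final-yields {f} f∉M y with f ∈? M | yields? f
    ... | yes f∈M | _     = ⊥-elim (f∉M f∈M)
    ... | no _    | yes _ = refl
    ... | no _    | no ¬y = ⊥-elim (¬y y)

    final-kept : ∀ {f} → f ∉ M → ¬ Yields f → final f ≡ c f
    final-kept {f} f∉M ¬y with f ∈? M | yields? f
    ... | yes f∈M | _     = ⊥-elim (f∉M f∈M)
    ... | no _    | yes y = ⊥-elim (¬y y)
    ... | no _    | no _  = refl

    view : ∀ f → View f
    view f with f ∈? M
    ... | yes f∈M = given f∈M (final-M f∈M)
    ... | no f∉M with yields? f | c f ≟ zero
    ...   | yes y | yes p = blank f∉M (final-yields f∉M y) p
    ...   | yes y | no ≢0 = yielded f∉M (final-yields f∉M y) ≢0 y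
    ...   | no ¬y | yes p = blank f∉M (trans (final-kept f∉M ¬y) p) p
    ...   | no ¬y | no ≢0 = kept (final-kept f∉M ¬y) ≢0 ¬y

    module _ {e f v} (e≢f : e ≢ f) (v∈e : v ∈ᵉ e) (v∈f : v ∈ᵉ f) where

      -- The edge of `M` to which `f` yields is within distance one of `e`, hence is `e`; so `e`
      -- takes the genuine old colour of `f`.
      given-yielded : e ∈ M → final e ≡ φ e → final f ≡ zero → c f ≢ zero → Yields f → final e ≢ final f
      given-yielded e∈M p q ≢0 (e′ , e′∈M , r , v′ , v′∈e′ , v′∈f) eq
        with near⇒≡ e∈M e′∈M v∈e v′∈e′ (via f v∈f v′∈f stay) (s≤s z≤n)
      ... | refl = ≢0 (trans (sym r) (trans (sym p) (trans eq q)))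

      given-kept : e ∈ M → final e ≡ φ e → final f ≡ c f → ¬ Yields f → final e ≢ final f
      given-kept e∈M p q ¬y eq = ¬y (e , e∈M , trans (sym p) (trans eq q) , v , v∈e , v∈f)

      ¬blank-yielded : e ∉ M → c e ≡ zero → c f ≢ zero → ¬ Yields f
      ¬blank-yielded e∉M p ≢0 (e′ , e′∈M , r , v′ , v′∈e′ , v′∈f) =
        settled e′∈M v′∈e′ (f , v′∈f , sym r , ≢0 , v , e , v∈f , v∈e , p , e∉M)

      -- The edges of `M` yielded to are within distance two, hence equal; so `e` and `f` would
      -- share a genuine colour at `v`.
      ¬yielded-yielded : c e ≢ zero → Yields e → ¬ Yields f
      ¬yielded-yielded ≢0 (e₁ , e₁∈M , p , v₁ , v₁∈e₁ , v₁∈e) (e₂ , e₂∈M , q , v₂ , v₂∈e₂ , v₂∈f)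
        with near⇒≡ e₁∈M e₂∈M v₁∈e₁ v₂∈e₂ (via e v₁∈e v∈e (via f v∈f v₂∈f stay)) (s≤s (s≤s z≤n))
      ... | refl = e≢f (proper v∈e v∈f (trans (sym p) q) ≢0)

    zero-kept : ∀ {x y z : Colour} → x ≡ zero → y ≡ z → z ≢ zero → x ≢ y
    zero-kept p q ≢0 eq = ≢0 (trans (sym q) (trans (sym eq) p))

    final-proper : ∀ {e f v} → e ≢ f → v ∈ᵉ e → v ∈ᵉ f → final e ≢ final f
    final-proper {e} {f} e≢f v∈e v∈f eq with view e | view f
    ... | given e∈M _       | given f∈M _      = e≢f (near⇒≡ e∈M f∈M v∈e v∈f stay z≤n)
    ... | given e∈M _       | blank _ _ q      = e≢f (matching v∈e v∈f (blankM e∈M) q)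
    ... | blank _ _ p       | given f∈M _      = e≢f (matching v∈e v∈f p (blankM f∈M))
    ... | given e∈M p       | yielded _ q ≢0 y = given-yielded e≢f v∈e v∈f e∈M p q ≢0 y eq
    ... | yielded _ q ≢0 y  | given f∈M p      = given-yielded (≢-sym e≢f) v∈f v∈e f∈M p q ≢0 y (sym eq)
    ... | given e∈M p       | kept q _ ¬y      = given-kept e≢f v∈e v∈f e∈M p q ¬y eq
    ... | kept q _ ¬y       | given f∈M p      = given-kept (≢-sym e≢f) v∈f v∈e f∈M p q ¬y (sym eq)
    ... | blank _ _ p       | blank _ _ q      = e≢f (matching v∈e v∈f p q)
    ... | blank e∉M _ p     | yielded _ _ ≢0 y = ¬blank-yielded e≢f v∈e v∈f e∉M p ≢0 y
    ... | yielded _ _ ≢0 y  | blank f∉M _ q    = ¬blank-yielded (≢-sym e≢f) v∈f v∈e f∉M q ≢0 y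
    ... | blank _ p _       | kept q ≢0 _      = zero-kept p q ≢0 eq
    ... | kept q ≢0 _       | blank _ p _      = zero-kept p q ≢0 (sym eq)
    ... | yielded _ _ ≢0 y  | yielded _ _ _ y′ = ¬yielded-yielded e≢f v∈e v∈f ≢0 y y′
    ... | yielded _ p _ _   | kept q ≢0 _      = zero-kept p q ≢0 eq
    ... | kept q ≢0 _       | yielded _ p _ _  = zero-kept p q ≢0 (sym eq)
    ... | kept p ≢0 _       | kept q _ _       = e≢f (proper v∈e v∈f (trans (sym p) (trans eq q)) ≢0)

    solution : Solution
    solution = final , (λ e f e≢f (v , v∈e , v∈f) → final-proper e≢f v∈e v∈f)
             , λ e → final-M

  -- Each stage either succeeds or finds a state with a smaller bound, from which everything
  -- restarts.
  solve : ∀ {z c} → State z c → Acc _<_ z → Solution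
  solve {z} S (acc rs) with match S (<-wellFounded _)
  ... | inj₁ (_ , _ , lt , S′) = solve S′ (rs lt)
  ... | inj₂ (c , S₁ , mt) with settleAll (allFin m) (record { state = S₁ ; matching = mt })
  ...   | inj₁ (_ , _ , lt , S′) = solve S′ (rs lt)
  ...   | inj₂ (c₂ , T , ok)     = Finish.solution T (λ {e} → ok (∈-allFin e))

  extension : Solution
  -- The wholly blank colouring is vacuously proper and has at most `m` blank edges.
  extension = solve {m} {λ _ → zero}
    (record { proper = λ _ _ _ ≢0 → ⊥-elim (≢0 refl) ; blankM = λ _ → refl
            ; few = unique⇒length≤ (blankEdges-unique _) })
    (<-wellFounded m)

-- Extending a distant precolouring with maximum degree plus multiplicity many colours.

theorem4 : {n m : ℕ} (G : Multigraph n m)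
    → ¬ HasC5 G
    → (M : Subset m)
    → (∀ e f → e ∈ M → f ∈ M → e ≢ f → EdgeDistAtLeast5 G e f)
    → (φ : (e : Fin m) → e ∈ M → Fin (maxDegree G + maxMultiplicity G))
    → Σ (Fin m → Fin (maxDegree G + maxMultiplicity G)) λ c →
    IsProperEdgeColouring G c × (∀ e (p : e ∈ M) → c e ≡ φ e p)
theorem4 {n} {m} G noC5 M far = colour _ refl
  where
  open Incidence G

  -- Naming the palette size `K` allows a case split: a colour can be set aside as blank only when
  -- `K` is a successor.
  colour : ∀ K → maxDegree G + maxMultiplicity G ≡ K → (φ : (e : Fin m) → e ∈ M → Fin K) →
    Σ (Fin m → Fin K) λ c → IsProperEdgeColouring G c × (∀ e (p : e ∈ M) → c e ≡ φ e p)
  colour zero eq φ = (λ e → ⊥-elim (no-edge e)) , (λ e → ⊥-elim (no-edge e)) , λ e → ⊥-elim (no-edge e)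
    where
    no-edge : Fin m → ⊥
    -- An end of an edge has positive degree, but an empty palette forces maximum degree zero.
    no-edge e = ℕₚ.<⇒≱ (∈-length (∈-filter-allFin⁺ (v ∈ᵉ?_) {e} (inj₁ refl)))
      (ℕₚ.≤-trans (degree≤maxDegree v) (ℕₚ.≤-reflexive (ℕₚ.m+n≡0⇒m≡0 _ eq)))
      where
      v : V
      v = proj₁ (ends e)
  colour (suc k) eq φ = c , c-proper , λ e p → trans (c-extends e p) (prescribed≡ e p)
    where
    prescribed : Fin m → Fin (suc k)
    prescribed e with e ∈? M
    ... | yes p = φ e p
    -- An arbitrary value: agreement is asked for only on `M`.
    ... | no  _ = zero
    prescribed≡ : ∀ e (p : e ∈ M) → prescribed e ≡ φ e p
    prescribed≡ e p with e ∈? M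
    -- Membership proofs are unique, so `φ e` takes the same value at `q` and `p`.
    ... | yes q = cong (φ e) ([]=-irrelevant q p)
    ... | no ¬p = ⊥-elim (¬p p)
    open Extension G k (maxDegree G) (maxMultiplicity G) degree≤maxDegree multiplicity≤maxMultiplicity
      eq noC5 M far prescribed using (extension)
    c : Fin m → Fin (suc k)
    c = proj₁ extension
    c-proper = proj₁ (proj₂ extension)
    c-extends = proj₂ (proj₂ extension)
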